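{- For any Dyck path $d$ of semilength $n$, the valley-swapping procedure described in the context terminates with a canon permutation of the form $\mathrm{can}(d,\tau)$, and the resulting permutation $\mathrm{vperm}(d)=\tau$ lies in $M_d$.
   Context: A Dyck path of semilength $n$ is a lattice path from $(0,0)$ to $(2n,0)$ with steps $U=(1,1)$ and $D=(1,-1)$ never going below the $x$-axis. For $\sigma=\sigma_1\cdots\sigma_n\in\mathfrak{S}_n$, $\mathrm{can}(d,\sigma)$ is the word of length $2n$ obtained by labeling the $i$-th up-step and the $i$-th down-step of $d$ with $\sigma_i$ and reading left to right; $\mathrm{des}(d,\sigma)$ is the number of $j\in[2n-1]$ with $\mathrm{can}(d,\sigma)_j>\mathrm{can}(d,\sigma)_{j+1}$; $m_d=\max_\sigma \mathrm{des}(d,\sigma)$ and $M_d=\{\sigma\in\mathfrak{S}_n\mid \mathrm{des}(d,\sigma)=m_d\}$. The bounce path of $d$: start at $(0,0)$, take up-steps until reaching a point of $d$ where $d$'s next step is a down-step, then take down-steps to the $x$-axis, then up-steps until again meeting a down-step of $d$, and so on until $(2n,0)$. For Dyck paths $d_1,d_2$ of the same semilength, $d_1$ is under $d_2$ if $d_1$ lies weakly below $d_2$. A valley is an occurrence of $DU$. Valley swap: given $\mathrm{can}(e,\sigma)$ and a valley of $e$ whose two steps carry labels $i$ and $j$ with $i<j$, the valley swap produces $\mathrm{can}(e',\sigma')$ where $e'$ is obtained from $e$ by replacing this $DU$ by $UD$, and $\sigma'$ is obtained from $\sigma$ by replacing the entry $i$ by $j$ and each entry $k\in\{i+1,\ldots,j\}$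 by $k-1$. Procedure: let $\delta_n=n(n-1)\cdots 1$ and start with $c=\mathrm{can}(\mathrm{bounce}(d),\delta_n)$. While the underlying Dyck path of $c$ is not $d$: find the leftmost valley of the underlying path of $c$ such that turning it into a peak yields a Dyck path under $d$, and replace $c$ by the result of the valley swap at that valley. -}

module Defs where

open import Data.Bool using (Bool; true; false; if_then_else_; _∧_; _∨_; not)
open import Data.Nat using (ℕ; zero; suc; _+_; _*_; _∸_; _≤_; _<ᵇ_; _≤ᵇ_; _≡ᵇ_)
open import Data.List using (List; []; _∷_; length; map; upTo; reverse; take; replicate; _++_)
open import Data.List.Relation.Binary.Permutation.Propositional using (_↭_)
open import Data.Maybe using (Maybe; just; nothing; _>>=_)
open import Data.Product using (_×_; _,_; proj₁)
open import Relation.Binary.PropositionalEquality using (_≡_)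

-- Dyck paths: lists of steps, true = U = (1,1), false = D = (1,-1)

Step : Set
Step = Bool

U D : Step
U = true
D = false

Path : Set
Path = List Step

ups : Path → ℕ
ups []          = 0
ups (true ∷ w)  = suc (ups w)
ups (false ∷ w) = ups w

downs : Path → ℕ
downs []          = 0
downs (true ∷ w)  = downs w
downs (false ∷ w) = suc (downs w)

record IsDyck (n : ℕ) (d : Path) : Set where
  field
    ups-n     : ups d ≡ n
    downs-n   : downs d ≡ n
    nonneg    : ∀ k → downs (take k d) ≤ ups (take k d)

nonnegᵇ : ℕ → ℕ → Path → Bool
nonnegᵇ u dn []          = true
nonnegᵇ u dn (true ∷ w)  = nonnegᵇ (suc u) dn w
nonnegᵇ u dn (false ∷ w) = (suc dn ≤ᵇ u) ∧ nonnegᵇ u (suc dn) w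

isDyckᵇ : Path → Bool
isDyckᵇ w = nonnegᵇ 0 0 w ∧ (ups w ≡ᵇ downs w)

-- e lies weakly below d (same length assumed/checked): at every prefix
-- length k, height_e(k) ≤ height_d(k), i.e.
-- ups_e(k) - downs_e(k) ≤ ups_d(k) - downs_d(k)
underᵇ : Path → Path → Bool
underᵇ e d = (length e ≡ᵇ length d) ∧ go (length e)
  where
  chk : ℕ → Bool
  chk k = (ups (take k e) + downs (take k d)) ≤ᵇ (ups (take k d) + downs (take k e))
  go : ℕ → Bool
  go zero    = chk zero
  go (suc k) = chk (suc k) ∧ go k

-- Permutations of [n] in one-line notation, values 1..n

oneToN : ℕ → List ℕ
oneToN n = map suc (upTo n)

IsPerm : ℕ → List ℕ → Set
IsPerm n σ = σ ↭ oneToN n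

δ : ℕ → List ℕ
δ n = reverse (oneToN n)

canAux : Path → List ℕ → List ℕ → List ℕ
canAux []          us       ds       = []
canAux (true ∷ w)  []       ds       = 0 ∷ canAux w [] ds
canAux (true ∷ w)  (x ∷ us) ds       = x ∷ canAux w us ds
canAux (false ∷ w) us       []       = 0 ∷ canAux w us []
canAux (false ∷ w) us       (x ∷ ds) = x ∷ canAux w us ds

can : Path → List ℕ → List ℕ
can d σ = canAux d σ σ

desW : List ℕ → ℕ
desW []           = 0
desW (x ∷ [])     = 0
desW (x ∷ y ∷ w)  = (if y <ᵇ x then 1 else 0) + desW (y ∷ w)

des : Path → List ℕ → ℕ
des d σ = desW (can d σ)

InM : ℕ → Path → List ℕ → Set
InM n d σ = IsPerm n σ × (∀ σ' → IsPerm n σ' → des d σ' ≤ des d σ)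

at : Path → ℕ → Maybe Step
at []      _       = nothing
at (x ∷ w) zero    = just x
at (x ∷ w) (suc k) = at w k

isDownAt : Path → ℕ → Bool
isDownAt d k with at d k
... | just false = true
... | _          = false

-- starting at the axis point with abscissa p, the bounce path after t up
-- steps is at (p+t, t); it stops there iff d passes through that point
-- (height_d(p+t) = t) and the next step of d is a down step.
bounceStop : Path → ℕ → ℕ → Bool
bounceStop d p t =
  (ups (take (p + t) d) ≡ᵇ (downs (take (p + t) d) + t)) ∧ isDownAt d (p + t)

findT : Path → ℕ → ℕ → ℕ → ℕ
findT d p t zero       = t
findT d p t (suc fuel) = if bounceStop d p t then t else findT d p (suc t) fuel

bounceFrom : Path → ℕ → ℕ → Path
bounceFrom d zero       p = []
bounceFrom d (suc fuel) p =
  if length d ≤ᵇ p then []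
  else (let t = findT d p 0 (length d)
        in replicate t U ++ replicate t D ++ bounceFrom d fuel (p + (t + t)))

bounce : Path → Path
bounce d = bounceFrom d (length d) 0

swapAt : ℕ → Path → Path
swapAt zero    (false ∷ true ∷ w) = true ∷ false ∷ w
swapAt zero    w                  = w
swapAt (suc j) []                 = []
swapAt (suc j) (x ∷ w)            = x ∷ swapAt j w

isValleyAt : Path → ℕ → Bool
isValleyAt (false ∷ true ∷ w) zero    = true
isValleyAt _                  zero    = false
isValleyAt []                 (suc j) = false
isValleyAt (x ∷ w)            (suc j) = isValleyAt w j

labelAt : List ℕ → ℕ → ℕ
labelAt []      _       = 0
labelAt (x ∷ w) zero    = x
labelAt (x ∷ w) (suc k) = labelAt w k

relabel : ℕ → ℕ → List ℕ → List ℕ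
relabel i j = map f
  where
  f : ℕ → ℕ
  f x = if x ≡ᵇ i then j else (if (i <ᵇ x) ∧ (x ≤ᵇ j) then x ∸ 1 else x)

valleySwap : ℕ → Path × List ℕ → Maybe (Path × List ℕ)
valleySwap v (e , σ) =
  let w = can e σ
      a = labelAt w v
      b = labelAt w (suc v)
  in if a <ᵇ b then just (swapAt v e , relabel a b σ)
     else if b <ᵇ a then just (swapAt v e , relabel b a σ)
     else nothing

admissible : Path → Path → ℕ → Bool
admissible d e v = isValleyAt e v ∧ isDyckᵇ (swapAt v e) ∧ underᵇ (swapAt v e) d

leftmost : Path → Path → ℕ → ℕ → Maybe ℕ
leftmost d e v zero       = nothing
leftmost d e v (suc fuel) = if admissible d e v then just v else leftmost d e (suc v) fuel

step : Path → Path × List ℕ → Maybe (Path × List ℕ)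
step d (e , σ) with leftmost d e 0 (length e)
... | nothing = nothing
... | just v  = valleySwap v (e , σ)

pathEqᵇ : Path → Path → Bool
pathEqᵇ []          []          = true
pathEqᵇ (x ∷ w)     (y ∷ v)     = (if x then y else not y) ∧ pathEqᵇ w v
pathEqᵇ _           _           = false

-- run the while loop for at most `fuel` iterations: returns the final state
-- (whose underlying path is d) if the loop has stopped within `fuel` steps,
-- nothing otherwise (or if a step is undefined)
run : ℕ → Path → Path × List ℕ → Maybe (Path × List ℕ)
run zero       d c = if pathEqᵇ (proj₁ c) d then just c else nothing
run (suc fuel) d c = if pathEqᵇ (proj₁ c) d then just c else (step d c >>= run fuel d)

-- the procedure, started from can(bounce(d), δ_n)
initial : ℕ → Path → Path × List ℕ
initial n d = (bounce d , δ n)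

{-# OPTIONS --safe #-}

-- Let b be the number of peaks of the bounce path. Before each bounce peak, the first up-step of the current bounce block and
-- the down-step at that peak carry the same label, so the word between them contains a weak ascent. These stretches are
-- disjoint, which gives des(d,σ) + b ≤ 2n − 1 for every σ.
--
-- The procedure moves the up-steps one after the other, from left to right, to their place in d, each crossing down-steps of
-- the previous block only. Within a block the labels stay decreasing, so a moving label is smaller than the one it crosses;
-- the swap puts it immediately above the crossed label and preserves all other comparisons. Once placed, the
-- up-step and the down-steps of the previous block form descents with what precedes them, so that in the final word only the
-- down-steps at the b bounce peaks can fail to create a descent, and the bound is attained.
module Submission where

open import Defs
open import Data.Bool using (Bool; true; false; T; _∧_; if_then_else_)
open import Data.Bool.Properties using (T-≡)
open import Data.Empty using (⊥-elim)
open import Data.List using (List; []; _∷_; _++_; _∷ʳ_; length; map; applyUpTo; upTo; downFrom; take; drop; replicate; initLast; _∷ʳ′_)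
open import Data.List.Properties using (++-assoc; ++-identityʳ; ∷ʳ-++; length-++; length-map; length-replicate; length-upTo; map-++; map-id-local; reverse-map; reverse-upTo; drop-all)
open import Data.List.Relation.Binary.Permutation.Propositional using (_↭_; ↭-sym; ↭-trans; module PermutationReasoning)
open import Data.List.Relation.Binary.Permutation.Propositional.Properties using (All-resp-↭; ↭-length; ↭-reverse; ++⁺ˡ) renaming (map⁺ to map⁺-↭; shift to shift-↭)
open import Data.List.Relation.Unary.All using (All; []; _∷_)
import Data.List.Relation.Unary.All as All
import Data.List.Relation.Unary.All.Properties as All
open import Data.List.Relation.Unary.AllPairs using (AllPairs; []; _∷_)
import Data.List.Relation.Unary.AllPairs.Properties as AllPairs
open import Data.Maybe using (just)
open import Data.Nat using (ℕ; zero; suc; pred; _+_; _∸_; _≤_; _<_; _>_; z≤n; s≤s; s≤s⁻¹; _<ᵇ_; _≤ᵇ_; _≡ᵇ_)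
open import Data.Nat.Properties
open import Data.Nat.Tactic.RingSolver using (solve-∀)
open import Data.Product using (Σ; ∃; ∃₂; _×_; _,_; proj₁; proj₂)
open import Data.Unit using (tt)
open import Function using (_∘_)
open import Function.Bundles using (Equivalence)
open import Relation.Binary.Definitions using (tri<; tri≈; tri>)
open import Relation.Binary.PropositionalEquality
open import Relation.Nullary using (¬_; contradiction; yes; no)

-- Boolean tests and the propositions they decide.

T⇒≡true : ∀ {b} → T b → b ≡ true
T⇒≡true = Equivalence.to T-≡

≡true⇒T : ∀ {b} → b ≡ true → T b
≡true⇒T = Equivalence.from T-≡

¬T⇒≡false : ∀ {b} → ¬ T b → b ≡ false
¬T⇒≡false {false} _  = refl
¬T⇒≡false {true}  ¬t = ⊥-elim (¬t tt)

<⇒<ᵇ≡true : ∀ {m n} → m < n → (m <ᵇ n) ≡ true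
<⇒<ᵇ≡true = T⇒≡true ∘ <⇒<ᵇ

≤⇒<ᵇ≡false : ∀ {m n} → n ≤ m → (m <ᵇ n) ≡ false
≤⇒<ᵇ≡false {m} {n} n≤m = ¬T⇒≡false (λ t → ≤⇒≯ n≤m (<ᵇ⇒< m n t))

≤⇒≤ᵇ≡true : ∀ {m n} → m ≤ n → (m ≤ᵇ n) ≡ true
≤⇒≤ᵇ≡true = T⇒≡true ∘ ≤⇒≤ᵇ

<⇒≤ᵇ≡false : ∀ {m n} → n < m → (m ≤ᵇ n) ≡ false
<⇒≤ᵇ≡false {m} {n} n<m = ¬T⇒≡false (λ t → <⇒≱ n<m (≤ᵇ⇒≤ m n t))

≡⇒≡ᵇ≡true : ∀ {m n} → m ≡ n → (m ≡ᵇ n) ≡ true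
≡⇒≡ᵇ≡true {m} {n} = T⇒≡true ∘ ≡⇒≡ᵇ m n

≢⇒≡ᵇ≡false : ∀ {m n} → m ≢ n → (m ≡ᵇ n) ≡ false
≢⇒≡ᵇ≡false {m} {n} m≢n = ¬T⇒≡false (m≢n ∘ ≡ᵇ⇒≡ m n)

∧-true : ∀ {a b} → a ≡ true → b ≡ true → a ∧ b ≡ true
∧-true refl refl = refl

∧-trueˡ : ∀ {a b} → a ∧ b ≡ true → a ≡ true
∧-trueˡ {true} _ = refl

∧-trueʳ : ∀ {a b} → a ∧ b ≡ true → b ≡ true
∧-trueʳ {true} eq = eq

-- Relabelling

-- A nameable copy of the function local to `relabel`. On values it is the cycle i → j → j - 1 → ...
-- → i + 1 → i.
cycle : ℕ → ℕ → ℕ → ℕ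
cycle i j x = if x ≡ᵇ i then j else (if (i <ᵇ x) ∧ (x ≤ᵇ j) then x ∸ 1 else x)

relabel≡map-cycle : ∀ i j σ → relabel i j σ ≡ map (cycle i j) σ
relabel≡map-cycle i j []      = refl
relabel≡map-cycle i j (x ∷ σ) = cong (cycle i j x ∷_) (relabel≡map-cycle i j σ)

cycle-self : ∀ i j → cycle i j i ≡ j
cycle-self i j rewrite ≡⇒≡ᵇ≡true {i} refl = refl

cycle-below : ∀ {i j x} → x < i → cycle i j x ≡ x
cycle-below x<i rewrite ≢⇒≡ᵇ≡false (<⇒≢ x<i) | ≤⇒<ᵇ≡false (<⇒≤ x<i) = refl

cycle-between : ∀ {i j x} → i < x → x ≤ j → cycle i j x ≡ x ∸ 1
cycle-between i<x x≤j rewrite ≢⇒≡ᵇ≡false (≢-sym (<⇒≢ i<x)) | <⇒<ᵇ≡true i<x | ≤⇒≤ᵇ≡true x≤j = refl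

cycle-above : ∀ {i j x} → i < j → j < x → cycle i j x ≡ x
cycle-above i<j j<x
  rewrite ≢⇒≡ᵇ≡false (≢-sym (<⇒≢ (<-trans i<j j<x))) | <⇒<ᵇ≡true (<-trans i<j j<x) | <⇒≤ᵇ≡false j<x = refl

-- Covers the arguments other than `i`. In `between` the image is the index and the argument its
-- successor, which removes truncated subtraction from later case splits.
data CycleView (i j : ℕ) : ℕ → ℕ → Set where
  below   : ∀ {x} → x < i → CycleView i j x x
  between : ∀ {x} → i ≤ x → x < j → CycleView i j (suc x) x
  above   : ∀ {x} → j < x → CycleView i j x x

cycleView : ∀ {i j x} → i < j → x ≢ i → CycleView i j x (cycle i j x)
cycleView {i} {j} {x} i<j x≢i with <-cmp x i
... | tri< x<i _ _ rewrite cycle-below {j = j} x<i = below x<i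
... | tri≈ _ x≡i _ = contradiction x≡i x≢i
... | tri> _ _ i<x with x ≤? j
...   | no x≰j rewrite cycle-above i<j (≰⇒> x≰j) = above (≰⇒> x≰j)
cycleView {i} {j} {suc x} i<j x≢i | tri> _ _ i<x | yes x≤j rewrite cycle-between i<x x≤j = between (s≤s⁻¹ i<x) x≤j

-- Away from `i` the cycle only closes the gap left at `i` and opens one at `j`, so relative order
-- survives. This is why a swap keeps all comparisons not involving the moving label.
cycle-mono-< : ∀ {i j x y} → i < j → x ≢ i → y ≢ i → x < y → cycle i j x < cycle i j y
cycle-mono-< {i} {j} {x} {y} i<j x≢i y≢i x<y
  with cycle i j x | cycleView i<j x≢i | cycle i j y | cycleView i<j y≢i
... | _ | below x<i     | _ | below _       = x<y
... | _ | below x<i     | _ | between i≤y _ = <-≤-trans x<i i≤y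
... | _ | below _       | _ | above _       = x<y
... | _ | between i≤x _ | _ | below y<i     = contradiction (<-trans (<-≤-trans x<y (<⇒≤ y<i)) (s≤s i≤x)) (<-irrefl refl)
... | _ | between _ _   | _ | between _ _   = s≤s⁻¹ x<y
... | _ | between _ _   | _ | above _       = <-trans ≤-refl x<y
... | _ | above _       | _ | below _       = x<y
... | _ | above j<x     | _ | between _ y<j = contradiction (<-≤-trans x<y y<j) (<-asym j<x)
... | _ | above _       | _ | above _       = x<y

-- Keeps the swept word free of the moving label: it avoids the old value `i` before a swap, hence
-- the new value `j` after it.
cycle-≢ : ∀ {i j x} → i < j → x ≢ i → cycle i j x ≢ j
cycle-≢ {i} {j} {x} i<j x≢i with cycle i j x | cycleView i<j x≢i
... | _ | below x<i     = <⇒≢ (<-trans x<i i<j)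
... | _ | between _ x<j = <⇒≢ x<j
... | _ | above j<x     = ≢-sym (<⇒≢ j<x)

cycle-> : ∀ {i j x c} → i < j → x ≢ i → c < i → c < x → c < cycle i j x
cycle-> {i} {j} {x} i<j x≢i c<i c<x with cycle i j x | cycleView i<j x≢i
... | _ | below _       = c<x
... | _ | between i≤x _ = <-≤-trans c<i i≤x
... | _ | above _       = c<x

-- Consecutive labels, and why relabelling keeps a permutation.

interval : ℕ → ℕ → List ℕ
interval s zero    = []
interval s (suc k) = s ∷ interval (suc s) k

interval-++ : ∀ s k l → interval s (k + l) ≡ interval s k ++ interval (s + k) l
interval-++ s zero    l rewrite +-identityʳ s = refl
interval-++ s (suc k) l rewrite +-suc s k = cong (s ∷_) (interval-++ (suc s) k l)

map-interval : ∀ (f : ℕ → ℕ) s t k → (∀ i → i < k → f (s + i) ≡ t + i) → map f (interval s k) ≡ interval t k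
map-interval f s t zero    _  = refl
map-interval f s t (suc k) eq = cong₂ _∷_
  (subst₂ (λ a b → f a ≡ b) (+-identityʳ s) (+-identityʳ t) (eq 0 (s≤s z≤n)))
  (map-interval f (suc s) (suc t) k
    (λ i i<k → subst₂ (λ a b → f a ≡ b) (+-suc s i) (+-suc t i) (eq (suc i) (s≤s i<k))))

upTo-interval : ∀ n → upTo n ≡ interval 0 n
upTo-interval n = go 0 n (λ i → i) (λ i → refl)
  where
  go : ∀ s n (f : ℕ → ℕ) → (∀ i → f i ≡ s + i) → applyUpTo f n ≡ interval s n
  go s zero    f eq = refl
  go s (suc n) f eq = cong₂ _∷_ (trans (eq 0) (+-identityʳ s))
    (go (suc s) n (f ∘ suc) (λ i → trans (eq (suc i)) (+-suc s i)))

oneToN-interval : ∀ n → oneToN n ≡ interval 1 n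
oneToN-interval n rewrite upTo-interval n = map-interval suc 0 1 n (λ _ _ → refl)

-- Here `p` values lie below `i`, `q` strictly between `i` and `j`, and `r` above `j`. The outer
-- pieces are fixed, the piece after `i` slides down by one, and `j`, now in front of it, is carried
-- back behind it.
map-cycle-interval : ∀ p q r → let i = suc p ; j = suc p + suc q in
  map (cycle i j) (interval 1 (p + (suc (suc q) + r))) ↭ interval 1 (p + (suc (suc q) + r))
map-cycle-interval p q r = begin
  map f (interval 1 (p + (suc (suc q) + r)))
    ≡⟨ cong (map f) split ⟩
  map f (interval 1 p ++ i ∷ interval (suc i) (suc q) ++ interval (i + suc (suc q)) r)
    ≡⟨ map-++ f (interval 1 p) _ ⟩
  map f (interval 1 p) ++ f i ∷ map f (interval (suc i) (suc q) ++ interval (i + suc (suc q)) r)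
    ≡⟨ cong₂ _++_ fixˡ (cong₂ _∷_ (cycle-self i j) (trans (map-++ f (interval (suc i) (suc q)) _) (cong₂ _++_ moved fixʳ))) ⟩
  interval 1 p ++ j ∷ interval i (suc q) ++ interval (i + suc (suc q)) r
    ↭⟨ ++⁺ˡ (interval 1 p) (shift-↭ j (interval i (suc q)) _) ⟨
  interval 1 p ++ interval i (suc q) ++ j ∷ interval (i + suc (suc q)) r
    ≡⟨ cong (interval 1 p ++_) rejoin ⟩
  interval 1 p ++ interval i (suc (suc q)) ++ interval (i + suc (suc q)) r
    ≡⟨ split ⟨
  interval 1 (p + (suc (suc q) + r)) ∎
  where
  open PermutationReasoning
  i = suc p
  j = suc p + suc q
  f = cycle i j
  i<j : i < j
  i<j = m<m+n i (s≤s z≤n)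
  split : interval 1 (p + (suc (suc q) + r))
        ≡ interval 1 p ++ interval i (suc (suc q)) ++ interval (i + suc (suc q)) r
  split = trans (interval-++ 1 p _) (cong (interval 1 p ++_) (interval-++ i (suc (suc q)) r))
  fixˡ : map f (interval 1 p) ≡ interval 1 p
  fixˡ = map-interval f 1 1 p (λ k k<p → cycle-below (s≤s k<p))
  moved : map f (interval (suc i) (suc q)) ≡ interval i (suc q)
  moved = map-interval f (suc i) i (suc q)
    (λ k k<q → cycle-between (s≤s (m≤m+n i k)) (subst (_≤ j) (+-suc i k) (+-monoʳ-≤ i k<q)))
  fixʳ : map f (interval (i + suc (suc q)) r) ≡ interval (i + suc (suc q)) r
  fixʳ = map-interval f (i + suc (suc q)) (i + suc (suc q)) r
    (λ k _ → cycle-above i<j (<-≤-trans (+-monoʳ-< i ≤-refl) (m≤m+n _ k)))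
  rejoin : interval i (suc q) ++ j ∷ interval (i + suc (suc q)) r
         ≡ interval i (suc (suc q)) ++ interval (i + suc (suc q)) r
  rejoin = trans (cong (λ z → interval i (suc q) ++ j ∷ interval z r) (+-suc i (suc q)))
    (trans (sym (interval-++ i (suc q) (suc r)))
    (trans (cong (interval i) (+-suc (suc q) r)) (interval-++ i (suc (suc q)) r)))

relabel-perm : ∀ {n i j σ} → 0 < i → i < j → j ≤ n → IsPerm n σ → IsPerm n (relabel i j σ)
relabel-perm {n} {suc p} {j} {σ} _ i<j j≤n perm
  with m≤n⇒∃[o]m+o≡n i<j | m≤n⇒∃[o]m+o≡n j≤n
... | q , refl | r , refl rewrite relabel≡map-cycle (suc p) (suc (suc p) + q) σ =
  ↭-trans (map⁺-↭ f perm) (subst (λ l → map f l ↭ l) (sym (oneToN-interval _))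
    (subst₂ (λ k m → map (cycle (suc p) k) (interval 1 m) ↭ interval 1 m)
      (+-suc (suc p) q) eq (map-cycle-interval p q r)))
  where
  f = cycle (suc p) (suc (suc p) + q)
  eq : p + (suc (suc q) + r) ≡ suc (suc p) + q + r
  eq = trans (+-suc p _) (cong suc (trans (+-suc p _) (cong suc (sym (+-assoc p q r)))))

IsPerm⇒All≤ : ∀ {n σ} → IsPerm n σ → All (_≤ n) σ
IsPerm⇒All≤ {n} perm = All-resp-↭ (↭-sym perm) (subst (All (_≤ n)) (sym (oneToN-interval n)) (bounded 1 n ≤-refl))
  where
  bounded : ∀ s k → s + k ≤ suc n → All (_≤ n) (interval s k)
  bounded s zero    _ = []
  bounded s (suc k) p = s≤s⁻¹ (≤-trans (s≤s (m≤m+n s k)) p') ∷ bounded (suc s) k p'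
    where p' = subst (_≤ suc n) (+-suc s k) p

δ≡downFrom : ∀ n → δ n ≡ map suc (downFrom n)
δ≡downFrom n = trans (sym (reverse-map suc (upTo n))) (cong (map suc) (reverse-upTo n))

-- Paths

ups-++ : ∀ p q → ups (p ++ q) ≡ ups p + ups q
ups-++ []          q = refl
ups-++ (true ∷ p)  q = cong suc (ups-++ p q)
ups-++ (false ∷ p) q = ups-++ p q

downs-++ : ∀ p q → downs (p ++ q) ≡ downs p + downs q
downs-++ []          q = refl
downs-++ (true ∷ p)  q = downs-++ p q
downs-++ (false ∷ p) q = cong suc (downs-++ p q)

ups-∷ʳ-U : ∀ p → ups (p ∷ʳ U) ≡ suc (ups p)
ups-∷ʳ-U p = trans (ups-++ p _) (+-comm (ups p) 1)

ups-∷ʳ-D : ∀ p → ups (p ∷ʳ D) ≡ ups p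
ups-∷ʳ-D p = trans (ups-++ p _) (+-identityʳ _)

downs-∷ʳ-D : ∀ p → downs (p ∷ʳ D) ≡ suc (downs p)
downs-∷ʳ-D p = trans (downs-++ p _) (+-comm (downs p) 1)

downs-∷ʳ-U : ∀ p → downs (p ∷ʳ U) ≡ downs p
downs-∷ʳ-U p = trans (downs-++ p _) (+-identityʳ _)

length≡ups+downs : ∀ p → length p ≡ ups p + downs p
length≡ups+downs []          = refl
length≡ups+downs (true ∷ p)  = cong suc (length≡ups+downs p)
length≡ups+downs (false ∷ p) = trans (cong suc (length≡ups+downs p)) (sym (+-suc (ups p) (downs p)))

take-length-++ : ∀ {A : Set} (p q : List A) → take (length p) (p ++ q) ≡ p
take-length-++ []      q = refl
take-length-++ (x ∷ p) q = cong (x ∷_) (take-length-++ p q)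

at-length-++ : ∀ p x q → at (p ++ x ∷ q) (length p) ≡ just x
at-length-++ []      x q = refl
at-length-++ (_ ∷ p) x q = at-length-++ p x q

length-take-at : ∀ d k {x} → at d k ≡ just x → length (take k d) ≡ k
length-take-at (x ∷ d) zero    _  = refl
length-take-at (x ∷ d) (suc k) eq = cong suc (length-take-at d k eq)

-- A down-step is determined by the number of down-steps before it; this makes the stopping point of
-- a bounce unique.
down-position-unique : ∀ q r k → at (q ++ D ∷ r) k ≡ just D → downs (take k (q ++ D ∷ r)) ≡ downs q → k ≡ length q
down-position-unique []          r zero    _  _  = refl
down-position-unique (false ∷ q) r (suc k) p  eq = cong suc (down-position-unique q r k p (suc-injective eq))
down-position-unique (true ∷ q)  r (suc k) p  eq = cong suc (down-position-unique q r k p eq)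

nonneg⇒nonnegᵇ : ∀ w {u v} → (∀ k → downs (take k w) + v ≤ ups (take k w) + u) → nonnegᵇ u v w ≡ true
nonneg⇒nonnegᵇ []          h = refl
nonneg⇒nonnegᵇ (true ∷ w)  {u} h =
  nonneg⇒nonnegᵇ w (λ k → ≤-trans (h (suc k)) (≤-reflexive (sym (+-suc (ups (take k w)) u))))
nonneg⇒nonnegᵇ (false ∷ w) {u} {v} h = ∧-true (≤⇒≤ᵇ≡true (h 1))
  (nonneg⇒nonnegᵇ w (λ k → ≤-trans (≤-reflexive (+-suc (downs (take k w)) v)) (h (suc k))))

-- Sweeping

-- Sweep m g w e: some prefix of d has been processed and w is the rest of d, while the current path is the same prefix
-- followed by D^m e. The current bounce block has g of its up-steps in the prefix, and the previous block still owes
-- m down-steps. A peak closes the block: its g up-steps now owe g down-steps, the first of which is taken at once.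
data Sweep : ℕ → ℕ → Path → Path → Set where
  end  : Sweep 0 0 [] []
  down : ∀ {m g w e} → Sweep m g w e → Sweep (suc m) g (D ∷ w) e
  up   : ∀ {m g w e} → Sweep m (suc g) w e → Sweep m g (U ∷ w) (U ∷ e)
  peak : ∀ {g w e} → Sweep g 0 w e → Sweep 0 (suc g) (D ∷ w) (replicate (suc g) D ++ e)

peaks : ∀ {m g w e} → Sweep m g w e → ℕ
peaks end      = 0
peaks (down S) = peaks S
peaks (up S)   = peaks S
peaks (peak S) = suc (peaks S)

-- With `u` up-steps and `v` down-steps behind, the height of d is m + g. The stuck cases are thus a
-- path ending above the axis and a down-step taken on the axis.
sweep : ∀ w m g {u v} → u ≡ m + g + v → ups w + u ≡ downs w + v → nonnegᵇ u v w ≡ true → ∃ (Sweep m g w)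
sweep [] zero    zero    h bal nn = [] , end
sweep [] (suc m) g       {v = v} refl bal nn = contradiction (sym bal) (m≢1+n+m v)
sweep [] zero    (suc g) {v = v} refl bal nn = contradiction (sym bal) (m≢1+n+m v)
sweep (true ∷ w) m g {u} {v} refl bal nn =
  let e , S = sweep w m (suc g) {suc u} {v} (cong (_+ v) (sym (+-suc m g))) (trans (+-suc (ups w) u) bal) nn
  in U ∷ e , up S
sweep (false ∷ w) (suc m) g {u} {v} refl bal nn =
  let e , S = sweep w m g {u} {suc v} (sym (+-suc (m + g) v)) (trans bal (sym (+-suc (downs w) v))) (∧-trueʳ nn)
  in e , down S
sweep (false ∷ w) zero (suc g) {u} {v} refl bal nn =
  let e , S = sweep w g 0 {u} {suc v} (trans (sym (+-suc g v)) (cong (_+ suc v) (sym (+-identityʳ g))))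
                (trans bal (sym (+-suc (downs w) v))) (∧-trueʳ nn)
  in replicate (suc g) D ++ e , peak S
sweep (false ∷ w) zero zero {v = v} refl bal nn = contradiction (≤ᵇ⇒≤ (suc v) v (≡true⇒T (∧-trueˡ nn))) (<-irrefl refl)

dyck-sweep : ∀ {n d} → IsDyck n d → ∃ (Sweep 0 0 d)
dyck-sweep {n} {d} dyck = sweep d 0 0 refl
  (cong (_+ 0) (trans ups-n (sym downs-n)))
  (nonneg⇒nonnegᵇ d (λ k → +-monoˡ-≤ 0 (nonneg k)))
  where open IsDyck dyck

data AtPeak : ℕ → Path → Path → Set where
  end  : AtPeak 0 [] []
  peak : ∀ {g w e} → Sweep g 0 w e → AtPeak (suc g) (D ∷ w) (replicate (suc g) D ++ e)

-- Jumps to the next bounce peak, or to the end. Until then the rest `e` of the current path only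
-- goes up, while d interleaves the same up-steps with the `m` owed down-steps.
record ToPeak (m g : ℕ) (w e : Path) : Set where
  constructor toPeak
  field
    w₁ w₂ e₂ : Path
    w-split  : w ≡ w₁ ++ w₂
    e-split  : e ≡ replicate (ups w₁) U ++ e₂
    downs-w₁ : downs w₁ ≡ m
    atPeak   : AtPeak (g + ups w₁) w₂ e₂

sweep-toPeak : ∀ {m g w e} → Sweep m g w e → ToPeak m g w e
sweep-toPeak end = toPeak [] [] [] refl refl refl end
sweep-toPeak (down S) with sweep-toPeak S
... | toPeak w₁ w₂ e₂ refl refl refl a = toPeak (D ∷ w₁) w₂ e₂ refl refl refl a
sweep-toPeak {g = g} (up S) with sweep-toPeak S
... | toPeak w₁ w₂ e₂ refl refl refl a =
  toPeak (U ∷ w₁) w₂ e₂ refl refl refl (subst (λ k → AtPeak k w₂ e₂) (sym (+-suc g (ups w₁))) a)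
sweep-toPeak {g = suc g} {w = w} {e = e} (peak S) =
  toPeak [] w e refl refl refl (subst (λ k → AtPeak k w e) (sym (+-identityʳ (suc g))) (peak S))

-- The bounce path

isDownAt⇒at : ∀ d k → isDownAt d k ≡ true → at d k ≡ just D
isDownAt⇒at d k eq with at d k
isDownAt⇒at d k eq | just false = refl

at⇒isDownAt : ∀ d k → at d k ≡ just D → isDownAt d k ≡ true
at⇒isDownAt d k eq rewrite eq = refl

module _ (q r : Path) (s t : ℕ) (downs-q : downs q ≡ s) (ups-q : ups q ≡ s + t) where
  private
    d = q ++ D ∷ r
    p = s + s

  length-q : length q ≡ p + t
  length-q = trans (length≡ups+downs q) (trans (cong₂ _+_ ups-q downs-q) (rearrange s t))
    where
    rearrange : ∀ s t → s + t + s ≡ s + s + t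
    rearrange = solve-∀

  bounceStop-at : bounceStop d p t ≡ true
  bounceStop-at rewrite sym length-q | take-length-++ q (D ∷ r) =
    ∧-true (≡⇒≡ᵇ≡true (trans ups-q (cong (_+ t) (sym downs-q)))) (at⇒isDownAt d (length q) (at-length-++ q D r))

  -- A stop at `i` puts d at abscissa 2s + i and height `i`, hence after exactly `s` down-steps, and
  -- the next down-step is the one following `q`. By this uniqueness any stop `findT` meets is the
  -- right one.
  bounceStop-only : ∀ i → bounceStop d p i ≡ true → i ≡ t
  bounceStop-only i stop = +-cancelˡ-≡ p i t (trans (down-position-unique q r k isD (trans downs≡s (sym downs-q))) length-q)
    where
    k = p + i
    isD : at d k ≡ just D
    isD = isDownAt⇒at d k (∧-trueʳ stop)
    v = downs (take k d)
    height : ups (take k d) ≡ v + i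
    height = ≡ᵇ⇒≡ _ _ (≡true⇒T (∧-trueˡ stop))
    rearrange : ∀ v i → v + i + v ≡ v + v + i
    rearrange = solve-∀
    double : v + v ≡ s + s
    double = +-cancelʳ-≡ i (v + v) (s + s) (trans (sym (rearrange v i)) (trans (cong (_+ v) (sym height))
      (trans (sym (length≡ups+downs (take k d))) (length-take-at d k isD))))
    downs≡s : v ≡ s
    downs≡s = *-cancelˡ-≡ v s 2 (subst₂ _≡_ (cong (v +_) (sym (+-identityʳ v))) (cong (s +_) (sym (+-identityʳ s))) double)

  findT-stop : ∀ fuel i → i ≤ t → t ≤ i + fuel → findT d p i fuel ≡ t
  findT-stop zero       i i≤t t≤ = ≤-antisym i≤t (subst (t ≤_) (+-identityʳ i) t≤)
  findT-stop (suc fuel) i i≤t t≤ with bounceStop d p i in stop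
  ... | true  = bounceStop-only i stop
  ... | false = findT-stop fuel (suc i) (≤∧≢⇒< i≤t i≢t) (subst (t ≤_) (+-suc i fuel) t≤)
    where
    i≢t : i ≢ t
    i≢t refl with trans (sym bounceStop-at) stop
    ... | ()

-- The bounce returns to the axis at abscissa `ups p + ups p`, after the `m` owed down-steps,
-- whereas `p` ends `m` steps earlier. The induction goes from one bounce peak to the next.
bounceFrom-sweep : ∀ fuel p w {m e} → ups p ≡ downs p + m → Sweep m 0 w e → length w ≤ fuel →
  bounceFrom (p ++ w) fuel (ups p + ups p) ≡ e
bounceFrom-sweep zero       p [] up≡ end len = refl
bounceFrom-sweep (suc fuel) p w up≡ S len with sweep-toPeak S
... | toPeak w₁ w₂ e₂ refl refl refl a
  rewrite sym (++-assoc p w₁ w₂) = goal (ups w₁) refl w₂ e₂ len a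
  where
  s = ups p
  t = ups w₁
  q = p ++ w₁
  downs-q : downs q ≡ s
  downs-q = trans (downs-++ p w₁) (sym up≡)
  ups-q : ups q ≡ s + t
  ups-q = ups-++ p w₁
  length-q′ : length q ≡ s + s + t
  length-q′ = length-q q [] s t downs-q ups-q
  -- Replacing `ups w₁` by a variable lets the index of `AtPeak` be matched.
  goal : ∀ t′ → t ≡ t′ → ∀ w₂ e₂ → length (w₁ ++ w₂) ≤ suc fuel → AtPeak t′ w₂ e₂ →
    bounceFrom (q ++ w₂) (suc fuel) (s + s) ≡ replicate t′ U ++ e₂
  goal .0 t≡0 .[] .[] _ end
    rewrite ++-identityʳ q
          | ≤⇒≤ᵇ≡true {length q} {s + s} (≤-reflexive (trans length-q′ (trans (cong (s + s +_) t≡0) (+-identityʳ _))))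
    = refl
  goal (suc g) t≡ (_ ∷ w) _ len″ (peak {e = e} S′)
    rewrite <⇒≤ᵇ≡false {length (q ++ D ∷ w)} {s + s}
              (subst (s + s <_) (sym (trans (length-++ q) (trans (cong (_+ suc (length w)) length-q′) (+-assoc (s + s) t _))))
                (m<m+n (s + s) (<-≤-trans (s≤s z≤n) (m≤n+m (suc (length w)) t))))
          | findT-stop q w s (suc g) downs-q (trans ups-q (cong (s +_) t≡)) (length (q ++ D ∷ w)) 0 z≤n
              (subst (_≤ length (q ++ D ∷ w)) t≡
                (≤-trans (subst (t ≤_) (sym length-q′) (m≤n+m t (s + s))) (subst (length q ≤_) (sym (length-++ q)) (m≤m+n _ _))))
    = cong (λ z → replicate (suc g) U ++ replicate (suc g) D ++ z) tail
    where
    p′ = q ∷ʳ D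
    ups-p′ : ups p′ ≡ s + suc g
    ups-p′ = trans (ups-∷ʳ-D q) (trans ups-q (cong (s +_) t≡))
    rearrange : ∀ s g → s + s + (suc g + suc g) ≡ (s + suc g) + (s + suc g)
    rearrange = solve-∀
    len-w : length w ≤ fuel
    len-w = s≤s⁻¹ (≤-trans (subst (suc (length w) ≤_) (sym (length-++ w₁)) (m≤n+m _ (length w₁))) len″)
    tail : bounceFrom (q ++ D ∷ w) fuel (s + s + (suc g + suc g)) ≡ e
    tail = subst₂ (λ d k → bounceFrom d fuel k ≡ e) (∷ʳ-++ q D w)
      (trans (cong₂ _+_ ups-p′ ups-p′) (sym (rearrange s g)))
      (bounceFrom-sweep fuel p′ w
        (trans ups-p′ (trans (+-suc s g) (cong (_+ g) (sym (trans (downs-∷ʳ-D q) (cong suc downs-q)))))) S′ len-w)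

bounce-sweep : ∀ {d e} → Sweep 0 0 d e → bounce d ≡ e
bounce-sweep {d} S = bounceFrom-sweep (length d) [] d refl S ≤-refl

-- The upper bound

desW-∷-≤ : ∀ x w → desW (x ∷ w) ≤ suc (desW w)
desW-∷-≤ x []      = z≤n
desW-∷-≤ x (y ∷ w) with y <ᵇ x
... | true  = ≤-refl
... | false = n≤1+n _

desW-∷-bound : ∀ x w {k l} → desW w + k ≤ l → desW (x ∷ w) + k ≤ suc l
desW-∷-bound x w {k} h = ≤-trans (+-monoˡ-≤ k (desW-∷-≤ x w)) (s≤s h)

desW-∷-ascent : ∀ {x y} w {k l} → x ≤ y → desW (y ∷ w) + k ≤ l → desW (x ∷ y ∷ w) + k ≤ l
desW-∷-ascent w x≤y h rewrite ≤⇒<ᵇ≡false x≤y = h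

length-∷ʳ : ∀ {A : Set} (xs : List A) x → length (xs ∷ʳ x) ≡ suc (length xs)
length-∷ʳ xs x = trans (length-++ xs) (+-comm (length xs) 1)

mutual
  -- Here `x` is the letter read last, `A` the labels of the owed down-steps, `us` the up-labels
  -- ahead. Every remaining step makes at most one descent, and each peak ahead costs one. The three
  -- mutual statements follow a block: no up-step yet, no ascent since its first up-step, nothing
  -- assumed.
  desW-sweep : ∀ {m w e} (S : Sweep m 0 w e) x A us → length A ≡ m → length us ≡ ups w →
    desW (x ∷ canAux w us (A ++ us)) + peaks S ≤ length w
  desW-sweep end x A us _ _ = z≤n
  desW-sweep (down {w = w} S) x (a ∷ A) us lA lus =
    desW-∷-bound x (a ∷ canAux w us (A ++ us)) (desW-sweep S a A us (suc-injective lA) lus)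
  desW-sweep (up {w = w} S) x A (u ∷ us) lA lus =
    -- The first up-step of a block supplies both the last letter and the pending label, so the
    -- invariant starts by reflexivity.
    desW-∷-bound x (u ∷ canAux w us (A ++ u ∷ us)) (desW-sweep-pending S u u A [] us ≤-refl lA refl (suc-injective lus))

  -- ℓ labels both the first up-step of the current block and the down-step at the next bounce peak;
  -- x ≤ ℓ persists until a weak ascent occurs between them.
  desW-sweep-pending : ∀ {m g w e} (S : Sweep m (suc g) w e) x ℓ A B us → x ≤ ℓ →
    length A ≡ m → length B ≡ g → length us ≡ ups w →
    desW (x ∷ canAux w us (A ++ ℓ ∷ B ++ us)) + peaks S ≤ length w
  desW-sweep-pending (down {w = w} S) x ℓ (a ∷ A) B us x≤ℓ lA lB lus with a <? x
  ... | yes a<x = desW-∷-bound x (a ∷ canAux w us (A ++ ℓ ∷ B ++ us))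
    (desW-sweep-pending S a ℓ A B us (≤-trans (<⇒≤ a<x) x≤ℓ) (suc-injective lA) lB lus)
  ... | no a≮x = desW-∷-ascent (canAux w us (A ++ ℓ ∷ B ++ us)) (≮⇒≥ a≮x)
    (desW-sweep-any S a A (ℓ ∷ B) us (suc-injective lA) (cong suc lB) lus)
  desW-sweep-pending (up {w = w} S) x ℓ A B (u ∷ us) x≤ℓ lA lB lus
    rewrite sym (∷ʳ-++ B u us) with u <? x
  ... | yes u<x = desW-∷-bound x (u ∷ canAux w us (A ++ ℓ ∷ (B ∷ʳ u) ++ us))
    (desW-sweep-pending S u ℓ A (B ∷ʳ u) us (≤-trans (<⇒≤ u<x) x≤ℓ) lA (trans (length-∷ʳ B u) (cong suc lB)) (suc-injective lus))
  ... | no u≮x = desW-∷-ascent (canAux w us (A ++ ℓ ∷ (B ∷ʳ u) ++ us)) (≮⇒≥ u≮x)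
    (desW-sweep-any S u A (ℓ ∷ B ∷ʳ u) us lA (cong suc (trans (length-∷ʳ B u) (cong suc lB))) (suc-injective lus))
  desW-sweep-pending (peak {w = w} S) x ℓ [] B us x≤ℓ lA lB lus =
    -- The peak's down-step carries `ℓ`, so the inequality that persisted becomes the ascent that
    -- pays for this peak.
    desW-∷-ascent (canAux w us (B ++ us)) x≤ℓ
      (≤-trans (≤-reflexive (+-suc (desW (ℓ ∷ canAux w us (B ++ us))) (peaks S))) (s≤s (desW-sweep S ℓ B us lB lus)))

  -- The bound is weaker by one because the next peak is not yet paid for; the callers recover that
  -- unit from the ascent just found.
  desW-sweep-any : ∀ {m g w e} (S : Sweep m (suc g) w e) x A B us →
    length A ≡ m → length B ≡ suc g → length us ≡ ups w →
    desW (x ∷ canAux w us (A ++ B ++ us)) + peaks S ≤ suc (length w)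
  desW-sweep-any (down {w = w} S) x (a ∷ A) B us lA lB lus =
    desW-∷-bound x (a ∷ canAux w us (A ++ B ++ us)) (desW-sweep-any S a A B us (suc-injective lA) lB lus)
  desW-sweep-any (up {w = w} S) x A B (u ∷ us) lA lB lus rewrite sym (∷ʳ-++ B u us) =
    desW-∷-bound x (u ∷ canAux w us (A ++ (B ∷ʳ u) ++ us))
      (desW-sweep-any S u A (B ∷ʳ u) us lA (trans (length-∷ʳ B u) (cong suc lB)) (suc-injective lus))
  desW-sweep-any (peak {w = w} S) x [] (b ∷ B) us lA lB lus =
    desW-∷-bound x (b ∷ canAux w us (B ++ us))
      (≤-trans (≤-reflexive (+-suc (desW (b ∷ canAux w us (B ++ us))) (peaks S))) (s≤s (desW-sweep S b B us (suc-injective lB) lus)))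

-- Admissible valleys

-- The index is the current surplus of up-steps of the upper path. Since `lose` consumes a positive
-- surplus, the lower path never overtakes.
data Below : ℕ → Path → Path → Set where
  []   : ∀ {k} → Below k [] []
  same : ∀ {k x e d} → Below k e d → Below k (x ∷ e) (x ∷ d)
  gain : ∀ {k e d} → Below (suc k) e d → Below k (D ∷ e) (U ∷ d)
  lose : ∀ {k e d} → Below k e d → Below (suc k) (U ∷ e) (D ∷ d)

below-++ : ∀ p {e d} → Below 0 e d → Below 0 (p ++ e) (p ++ d)
below-++ []      b = b
below-++ (x ∷ p) b = same (below-++ p b)

below-length : ∀ {k e d} → Below k e d → length e ≡ length d
below-length []       = refl
below-length (same b) = cong suc (below-length b)
below-length (gain b) = cong suc (below-length b)
below-length (lose b) = cong suc (below-length b)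

below-take : ∀ {k e d} → Below k e d → ∀ i →
  ups (take i e) ≤ ups (take i d) + k × downs (take i d) ≤ downs (take i e) + k
below-take b zero = z≤n , z≤n
below-take [] (suc i) = z≤n , z≤n
below-take (same {x = true} b) (suc i) = let p , q = below-take b i in s≤s p , q
below-take (same {x = false} b) (suc i) = let p , q = below-take b i in p , s≤s q
below-take {k} (gain {e = e} {d} b) (suc i) = let p , q = below-take b i in
  subst (ups (take i e) ≤_) (+-suc (ups (take i d)) k) p , subst (downs (take i d) ≤_) (+-suc (downs (take i e)) k) q
below-take {suc k} (lose {e = e} {d} b) (suc i) = let p , q = below-take b i in
  subst (suc (ups (take i e)) ≤_) (sym (+-suc (ups (take i d)) k)) (s≤s p) ,
  subst (suc (downs (take i d)) ≤_) (sym (+-suc (downs (take i e)) k)) (s≤s q)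

below-swap : ∀ {k e d} → Below k (U ∷ D ∷ e) d → Below k (D ∷ U ∷ e) d
below-swap (same (same b)) = gain (lose b)
below-swap (same (gain b)) = gain (same b)
below-swap (lose (same b)) = same (lose b)
below-swap (lose (gain b)) = same (same b)

below-delay : ∀ j {k e d} → Below k (U ∷ replicate j D ++ e) d → Below k (replicate j D ++ U ∷ e) d
below-delay zero    b = b
below-delay (suc j) b with below-swap b
... | same b′ = same (below-delay j b′)
... | gain b′ = gain (below-delay j b′)

-- Unification solves belowUpTo to the local function of underᵇ, which cannot be named from here.
mutual
  belowUpTo : Path → Path → ℕ → Bool
  belowUpTo = _

  underᵇ-unfold : ∀ e d → underᵇ e d ≡ (length e ≡ᵇ length d) ∧ belowUpTo e d (length e)
  underᵇ-unfold e d with length e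
  ... | _ = refl

below⇒underᵇ : ∀ {e d} → Below 0 e d → underᵇ e d ≡ true
below⇒underᵇ {e} {d} b = trans (underᵇ-unfold e d) (∧-true (≡⇒≡ᵇ≡true (below-length b)) (holds (length e)))
  where
  holds-at : ∀ k → ((ups (take k e) + downs (take k d)) ≤ᵇ (ups (take k d) + downs (take k e))) ≡ true
  holds-at k = let p , q = below-take b k in
    ≤⇒≤ᵇ≡true (+-mono-≤ (≤-trans p (≤-reflexive (+-identityʳ _))) (≤-trans q (≤-reflexive (+-identityʳ _))))
  holds : ∀ k → belowUpTo e d k ≡ true
  holds zero    = refl
  holds (suc k) = ∧-true (holds-at (suc k)) (holds k)

underᵇ⇒≤ : ∀ e d → underᵇ e d ≡ true → ∀ {k} → k ≤ length e →
  ups (take k e) + downs (take k d) ≤ ups (take k d) + downs (take k e)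
underᵇ⇒≤ e d u = extract (length e) (∧-trueʳ (trans (sym (underᵇ-unfold e d)) u))
  where
  extract : ∀ l → belowUpTo e d l ≡ true → ∀ {k} → k ≤ l →
    ups (take k e) + downs (take k d) ≤ ups (take k d) + downs (take k e)
  extract zero    h {zero} _ = z≤n
  extract (suc l) h {k} k≤ with k ≟ suc l
  ... | yes refl = ≤ᵇ⇒≤ _ _ (≡true⇒T (∧-trueˡ h))
  ... | no k≢    = extract l (∧-trueʳ h) (s≤s⁻¹ (≤∧≢⇒< k≤ k≢))

take-suc-length-++ : ∀ {A : Set} (p : List A) x q → take (suc (length p)) (p ++ x ∷ q) ≡ p ∷ʳ x
take-suc-length-++ []      x q = refl
take-suc-length-++ (y ∷ p) x q = cong (y ∷_) (take-suc-length-++ p x q)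

-- The prefix ending just after the first difference is already too high.
underᵇ-crossing : ∀ p q r → underᵇ (p ++ U ∷ q) (p ++ D ∷ r) ≡ false
underᵇ-crossing p q r = ¬T⇒≡false λ t → impossible (subst₂ _≤_
    (cong₂ _+_ (trans (cong ups (take-suc-length-++ p U q)) (ups-∷ʳ-U p)) (trans (cong downs (take-suc-length-++ p D r)) (downs-∷ʳ-D p)))
    (cong₂ _+_ (trans (cong ups (take-suc-length-++ p D r)) (ups-∷ʳ-D p)) (trans (cong downs (take-suc-length-++ p U q)) (downs-∷ʳ-U p)))
    (underᵇ⇒≤ (p ++ U ∷ q) (p ++ D ∷ r) (T⇒≡true t) {suc (length p)}
      (subst (suc (length p) ≤_) (sym (length-++ p)) (≤-trans (≤-reflexive (+-comm 1 (length p))) (+-monoʳ-≤ (length p) (s≤s z≤n))))))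
  where
  impossible : ¬ (suc (ups p) + suc (downs p) ≤ ups p + downs p)
  impossible h = <-irrefl refl (<-≤-trans (s≤s (+-monoʳ-≤ (ups p) (n≤1+n (downs p)))) h)

isValleyAt-suc : ∀ x w j → isValleyAt (x ∷ w) (suc j) ≡ isValleyAt w j
isValleyAt-suc true  w           j = refl
isValleyAt-suc false []          j = refl
isValleyAt-suc false (true ∷ w)  j = refl
isValleyAt-suc false (false ∷ w) j = refl

isValleyAt-length-++ : ∀ p r → isValleyAt (p ++ D ∷ U ∷ r) (length p) ≡ true
isValleyAt-length-++ []      r = refl
isValleyAt-length-++ (x ∷ p) r = trans (isValleyAt-suc x _ (length p)) (isValleyAt-length-++ p r)

swapAt-length-++ : ∀ p r → swapAt (length p) (p ++ D ∷ U ∷ r) ≡ p ++ U ∷ D ∷ r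
swapAt-length-++ []      r = refl
swapAt-length-++ (x ∷ p) r = cong (x ∷_) (swapAt-length-++ p r)

-- What follows `p` starts with a down-step, so no valley straddles the boundary, and the run of
-- down-steps holds none before its last step. An earlier valley therefore lies wholly in `p`.
valley-in-prefix : ∀ p k r j → j < length p + k → isValleyAt (p ++ replicate k D ++ D ∷ U ∷ r) j ≡ true →
  ∃₂ λ p₁ p₂ → p ≡ p₁ ++ D ∷ U ∷ p₂ × length p₁ ≡ j
valley-in-prefix [] (suc zero)    r zero    _  ()
valley-in-prefix [] (suc (suc k)) r zero    _  ()
valley-in-prefix [] (suc k)       r (suc j) j< v
  with valley-in-prefix [] k r j (s≤s⁻¹ j<) (trans (sym (isValleyAt-suc D (replicate k D ++ D ∷ U ∷ r) j)) v)
... | []     , _ , () , _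
... | _ ∷ _  , _ , () , _
valley-in-prefix (x ∷ p) k r (suc j) j< v
  with valley-in-prefix p k r j (s≤s⁻¹ j<) (trans (sym (isValleyAt-suc x _ j)) v)
... | p₁ , p₂ , refl , l = x ∷ p₁ , p₂ , refl , cong suc l
valley-in-prefix (true ∷ _)               k       r zero _ ()
valley-in-prefix (false ∷ [])             zero    r zero _ ()
valley-in-prefix (false ∷ [])             (suc k) r zero _ ()
valley-in-prefix (false ∷ false ∷ p)      k       r zero _ ()
valley-in-prefix (false ∷ true ∷ p)       k       r zero _ v = [] , p , refl , refl

leftmost-just : ∀ d e k v fuel → (∀ j → j < k → admissible d e (v + j) ≡ false) →
  admissible d e (v + k) ≡ true → k < fuel → leftmost d e v fuel ≡ just (v + k)
leftmost-just d e zero    v (suc fuel) _     adm _  rewrite +-identityʳ v | adm = refl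
leftmost-just d e (suc k) v (suc fuel) early adm k<
  rewrite trans (cong (admissible d e) (sym (+-identityʳ v))) (early 0 (s≤s z≤n)) | +-suc v k =
  leftmost-just d e k (suc v) fuel (λ j j<k → trans (cong (admissible d e) (sym (+-suc v j))) (early (suc j) (s≤s j<k))) adm (s≤s⁻¹ k<)

-- The current path agrees with d on `p`. Any earlier valley lies in `p` and is a valley of d too,
-- so turning it into a peak would rise above d.
leftmost-valley : ∀ p w k r → let e = p ++ replicate k D ++ D ∷ U ∷ r
                                  e′ = p ++ replicate k D ++ U ∷ D ∷ r
                                  d = p ++ U ∷ w in
  isDyckᵇ e′ ≡ true → Below 0 e′ d → leftmost d e 0 (length e) ≡ just (length p + k)
leftmost-valley p w k r dyck e≤d = leftmost-just d e (length p + k) 0 (length e) early adm fits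
  where
  d = p ++ U ∷ w
  q = p ++ replicate k D
  e = p ++ replicate k D ++ D ∷ U ∷ r
  e≡ : e ≡ q ++ D ∷ U ∷ r
  e≡ = sym (++-assoc p _ _)
  length-q≡ : length q ≡ length p + k
  length-q≡ = trans (length-++ p) (cong (length p +_) (length-replicate k))
  fits : length p + k < length e
  fits = subst₂ _<_ length-q≡ (trans (sym (length-++ q)) (cong length (sym e≡))) (m<m+n (length q) (s≤s z≤n))
  swapped : swapAt (length p + k) e ≡ p ++ replicate k D ++ U ∷ D ∷ r
  swapped = trans (cong₂ swapAt (sym length-q≡) e≡) (trans (swapAt-length-++ q r) (++-assoc p _ _))
  adm : admissible d e (length p + k) ≡ true
  adm = ∧-true (trans (cong₂ isValleyAt e≡ (sym length-q≡)) (isValleyAt-length-++ q r))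
    (∧-true (trans (cong isDyckᵇ swapped) dyck) (trans (cong (λ z → underᵇ z d) swapped) (below⇒underᵇ e≤d)))
  early : ∀ j → j < length p + k → admissible d e j ≡ false
  early j j< = ¬T⇒≡false λ t → let a = T⇒≡true t in
    clash (valley-in-prefix p k r j j< (∧-trueˡ a)) (∧-trueʳ {isDyckᵇ (swapAt j e)} (∧-trueʳ {isValleyAt e j} a))
    where
    clash : (∃₂ λ p₁ p₂ → p ≡ p₁ ++ D ∷ U ∷ p₂ × length p₁ ≡ j) → ¬ (underᵇ (swapAt j e) d ≡ true)
    clash (p₁ , p₂ , refl , refl) under
      rewrite ++-assoc p₁ (D ∷ U ∷ p₂) (replicate k D ++ D ∷ U ∷ r)
            | ++-assoc p₁ (D ∷ U ∷ p₂) (U ∷ w)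
            | swapAt-length-++ p₁ (p₂ ++ replicate k D ++ D ∷ U ∷ r)
      with trans (sym under) (underᵇ-crossing p₁ (D ∷ p₂ ++ replicate k D ++ D ∷ U ∷ r) (U ∷ p₂ ++ U ∷ w))
    ... | ()

ups-replicate-D : ∀ k → ups (replicate k D) ≡ 0
ups-replicate-D zero    = refl
ups-replicate-D (suc k) = ups-replicate-D k

downs-replicate-D : ∀ k → downs (replicate k D) ≡ k
downs-replicate-D zero    = refl
downs-replicate-D (suc k) = cong suc (downs-replicate-D k)

ups-replicate-D-++ : ∀ k e → ups (replicate k D ++ e) ≡ ups e
ups-replicate-D-++ k e = trans (ups-++ (replicate k D) e) (cong (_+ ups e) (ups-replicate-D k))

downs-replicate-D-++ : ∀ k e → downs (replicate k D ++ e) ≡ k + downs e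
downs-replicate-D-++ k e = trans (downs-++ (replicate k D) e) (cong (_+ downs e) (downs-replicate-D k))

-- Canon words

drop-length-++ : ∀ {A : Set} (xs : List A) {ys} → drop (length xs) (xs ++ ys) ≡ ys
drop-length-++ []       = refl
drop-length-++ (x ∷ xs) = drop-length-++ xs

canAux-++ : ∀ p w us ds → canAux (p ++ w) us ds ≡ canAux p us ds ++ canAux w (drop (ups p) us) (drop (downs p) ds)
canAux-++ []          w us       ds       = refl
canAux-++ (true ∷ p)  w []       ds       = cong (0 ∷_) (trans (canAux-++ p w [] ds)
  (cong (λ z → canAux p [] ds ++ canAux w z (drop (downs p) ds)) (drop-all (ups p) [] z≤n)))
canAux-++ (true ∷ p)  w (x ∷ us) ds       = cong (x ∷_) (canAux-++ p w us ds)
canAux-++ (false ∷ p) w us       []       = cong (0 ∷_) (trans (canAux-++ p w us [])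
  (cong (λ z → canAux p us [] ++ canAux w (drop (ups p) us) z) (drop-all (downs p) [] z≤n)))
canAux-++ (false ∷ p) w us       (x ∷ ds) = cong (x ∷_) (canAux-++ p w us ds)

length-canAux : ∀ p us ds → length (canAux p us ds) ≡ length p
length-canAux []          us       ds       = refl
length-canAux (true ∷ p)  []       ds       = cong suc (length-canAux p [] ds)
length-canAux (true ∷ p)  (x ∷ us) ds       = cong suc (length-canAux p us ds)
length-canAux (false ∷ p) us       []       = cong suc (length-canAux p us [])
length-canAux (false ∷ p) us       (x ∷ ds) = cong suc (length-canAux p us ds)

-- The value 0 must be fixed because `canAux` emits it when labels run out.
map-canAux : ∀ (f : ℕ → ℕ) → f 0 ≡ 0 → ∀ p us ds → canAux p (map f us) (map f ds) ≡ map f (canAux p us ds)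
map-canAux f f0 []          us       ds       = refl
map-canAux f f0 (true ∷ p)  []       ds       = cong₂ _∷_ (sym f0) (map-canAux f f0 p [] ds)
map-canAux f f0 (true ∷ p)  (x ∷ us) ds       = cong (f x ∷_) (map-canAux f f0 p us ds)
map-canAux f f0 (false ∷ p) us       []       = cong₂ _∷_ (sym f0) (map-canAux f f0 p us [])
map-canAux f f0 (false ∷ p) us       (x ∷ ds) = cong (f x ∷_) (map-canAux f f0 p us ds)

labelAt-++ : ∀ xs ys k → labelAt (xs ++ ys) (k + length xs) ≡ labelAt ys k
labelAt-++ []       ys k = cong (labelAt ys) (+-identityʳ k)
labelAt-++ (x ∷ xs) ys k = trans (cong (labelAt (x ∷ xs ++ ys)) (+-suc k (length xs))) (labelAt-++ xs ys k)

step-at : ∀ d e σ {v y a} → leftmost d e 0 (length e) ≡ just v →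
  labelAt (can e σ) v ≡ a → labelAt (can e σ) (suc v) ≡ y → y < a →
  step d (e , σ) ≡ just (swapAt v e , relabel y a σ)
step-at d e σ {v} {y} {a} left a≡ y≡ y<a
  rewrite left | a≡ | y≡ | ≤⇒<ᵇ≡false (<⇒≤ y<a) | <⇒<ᵇ≡true y<a = refl

-- Before the valley the word has consumed `ups p` up-labels and `downs p + k` down-labels, so the
-- valley reads `a` then `y`. As y < a, the second branch of `valleySwap` fires.
step-swap : ∀ p w k r σ {y a us ds} → let e = p ++ replicate k D ++ D ∷ U ∷ r
                                          e′ = p ++ replicate k D ++ U ∷ D ∷ r
                                          d = p ++ U ∷ w in
  isDyckᵇ e′ ≡ true → Below 0 e′ d →
  drop (ups p) σ ≡ y ∷ us → drop (downs p + k) σ ≡ a ∷ ds → y < a →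
  step d (e , σ) ≡ just (e′ , relabel y a σ)
step-swap p w k r σ {y} {a} {us} {ds} dyck e≤d us≡ ds≡ y<a =
  trans (step-at (p ++ U ∷ w) e σ (leftmost-valley p w k r dyck e≤d) (label 0) (label 1) y<a)
    (cong (λ z → just (z , relabel y a σ)) swapped)
  where
  q = p ++ replicate k D
  e = p ++ replicate k D ++ D ∷ U ∷ r
  e≡ : e ≡ q ++ D ∷ U ∷ r
  e≡ = sym (++-assoc p _ _)
  length-q≡ : length q ≡ length p + k
  length-q≡ = trans (length-++ p) (cong (length p +_) (length-replicate k))
  ups-q≡ : ups q ≡ ups p
  ups-q≡ = trans (ups-++ p _) (trans (cong (ups p +_) (ups-replicate-D k)) (+-identityʳ _))
  downs-q≡ : downs q ≡ downs p + k
  downs-q≡ = trans (downs-++ p _) (cong (downs p +_) (downs-replicate-D k))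
  word : can e σ ≡ canAux q σ σ ++ a ∷ y ∷ canAux r us ds
  word = trans (cong (λ z → can z σ) e≡) (trans (canAux-++ q _ σ σ)
    (cong (canAux q σ σ ++_) (cong₂ (canAux (D ∷ U ∷ r)) (trans (cong (λ z → drop z σ) ups-q≡) us≡) (trans (cong (λ z → drop z σ) downs-q≡) ds≡))))
  label : ∀ i → labelAt (can e σ) (i + (length p + k)) ≡ labelAt (a ∷ y ∷ canAux r us ds) i
  label i = trans (cong₂ labelAt word (cong (i +_) (sym (trans (length-canAux q σ σ) length-q≡)))) (labelAt-++ (canAux q σ σ) _ i)
  swapped : swapAt (length p + k) e ≡ p ++ replicate k D ++ U ∷ D ∷ r
  swapped = trans (cong₂ swapAt (sym length-q≡) e≡) (trans (swapAt-length-++ q r) (++-assoc p _ _))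

pathEqᵇ-refl : ∀ d → pathEqᵇ d d ≡ true
pathEqᵇ-refl []          = refl
pathEqᵇ-refl (true ∷ d)  = pathEqᵇ-refl d
pathEqᵇ-refl (false ∷ d) = pathEqᵇ-refl d

pathEqᵇ-differ : ∀ p q r → pathEqᵇ (p ++ D ∷ q) (p ++ U ∷ r) ≡ false
pathEqᵇ-differ []          q r = refl
pathEqᵇ-differ (true ∷ p)  q r = pathEqᵇ-differ p q r
pathEqᵇ-differ (false ∷ p) q r = pathEqᵇ-differ p q r

-- Intermediate paths

nonnegᵇ-++ : ∀ p w u v → nonnegᵇ u v (p ++ w) ≡ nonnegᵇ u v p ∧ nonnegᵇ (ups p + u) (downs p + v) w
nonnegᵇ-++ []          w u v = refl
nonnegᵇ-++ (true ∷ p)  w u v = trans (nonnegᵇ-++ p w (suc u) v) (cong (λ z → nonnegᵇ (suc u) v p ∧ nonnegᵇ z (downs p + v) w) (+-suc (ups p) u))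
nonnegᵇ-++ (false ∷ p) w u v with suc v ≤ᵇ u
... | true  = trans (nonnegᵇ-++ p w u (suc v)) (cong (λ z → nonnegᵇ u (suc v) p ∧ nonnegᵇ (ups p + u) z w) (+-suc (downs p) v))
... | false = refl

nonnegᵇ-replicate-D : ∀ m e {u v} → m + v ≤ u → nonnegᵇ u (m + v) e ≡ true → nonnegᵇ u v (replicate m D ++ e) ≡ true
nonnegᵇ-replicate-D zero    e h nn = nn
nonnegᵇ-replicate-D (suc m) e {u} {v} h nn = ∧-true (≤⇒≤ᵇ≡true (≤-trans (s≤s (m≤n+m v m)) h))
  (nonnegᵇ-replicate-D m e (≤-trans (≤-reflexive (+-suc m v)) h) (trans (cong (λ z → nonnegᵇ u z e) (+-suc m v)) nn))

-- The path `e` begins after the owed down-steps, at height `g`.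
sweep-nonneg : ∀ {m g w e} → Sweep m g w e → ∀ {u v} → u ≡ g + v → nonnegᵇ u v e ≡ true
sweep-nonneg end      _  = refl
sweep-nonneg (down S) eq = sweep-nonneg S eq
sweep-nonneg (up S)   eq = sweep-nonneg S (cong suc eq)
sweep-nonneg (peak {g = g} {e = e} S) {u} {v} eq = nonnegᵇ-replicate-D (suc g) e (≤-reflexive (sym eq)) (sweep-nonneg S eq)

sweep-balance : ∀ {m g w e} → Sweep m g w e → downs e ≡ g + ups e
sweep-balance end      = refl
sweep-balance (down S) = sweep-balance S
sweep-balance {g = g} (up {e = e} S) = trans (sweep-balance S) (sym (+-suc g (ups e)))
sweep-balance (peak {g = g} {e = e} S) = trans (downs-replicate-D-++ (suc g) e)
  (cong (suc g +_) (trans (sweep-balance S) (sym (ups-replicate-D-++ (suc g) e))))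

-- Only the `up` case differs from d: there the current path takes the up-step after the owed
-- down-steps, and such a delay only lowers a path.
sweep-below : ∀ {m g w e} → Sweep m g w e → Below 0 (replicate m D ++ e) w
sweep-below end          = []
sweep-below (down S)     = same (sweep-below S)
sweep-below {m} (up S)   = below-delay m (same (sweep-below S))
sweep-below (peak S)     = same (sweep-below S)

replicate-++ : ∀ k l (e : Path) → replicate (k + l) D ++ e ≡ replicate k D ++ replicate l D ++ e
replicate-++ zero    l e = refl
replicate-++ (suc k) l e = cong (D ∷_) (replicate-++ k l e)

module _ {k l g : ℕ} {w e : Path} (S : Sweep (k + l) (suc g) w e) where

  -- These are the paths met while one up-step moves: `k` owed down-steps are still in front of it
  -- and `l` have been crossed.
  intermediate-below : ∀ p → Below 0 (p ++ replicate k D ++ U ∷ replicate l D ++ e) (p ++ U ∷ w)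
  intermediate-below p = below-++ p (below-delay k (same (subst (λ z → Below 0 z w) (replicate-++ k l e) (sweep-below S))))

  intermediate-dyck : ∀ p → nonnegᵇ 0 0 p ≡ true → ups p ≡ downs p + (k + l + g) →
    isDyckᵇ (p ++ replicate k D ++ U ∷ replicate l D ++ e) ≡ true
  intermediate-dyck p nn height = ∧-true
    (trans (nonnegᵇ-++ p _ 0 0) (∧-true nn
      (nonnegᵇ-replicate-D k _ (subst (k + v ≤_) (sym u≡) (≤-trans (m≤m+n (k + v) (l + g)) (≤-reflexive (r₂ k l g v))))
        (nonnegᵇ-replicate-D l e (subst (λ z → l + (k + v) ≤ suc z) (sym u≡) (≤-trans (m≤m+n _ (suc g)) (≤-reflexive (r₃ k l g v))))
          (sweep-nonneg S (trans (cong suc u≡) (r₄ k l g v)))))))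
    (≡⇒≡ᵇ≡true (begin
      ups (p ++ replicate k D ++ U ∷ replicate l D ++ e)
        ≡⟨ trans (ups-++ p _) (cong (ups p +_) (trans (ups-replicate-D-++ k _) (cong suc (ups-replicate-D-++ l e)))) ⟩
      ups p + suc (ups e)
        ≡⟨ cong (_+ suc (ups e)) height ⟩
      downs p + (k + l + g) + suc (ups e)
        ≡⟨ r₅ k l g (downs p) (ups e) ⟩
      downs p + (k + (l + (suc g + ups e)))
        ≡⟨ cong (λ z → downs p + (k + (l + z))) (sweep-balance S) ⟨
      downs p + (k + (l + downs e))
        ≡⟨ trans (downs-++ p _) (cong (downs p +_) (trans (downs-replicate-D-++ k _) (cong (k +_) (downs-replicate-D-++ l e)))) ⟨
      downs (p ++ replicate k D ++ U ∷ replicate l D ++ e) ∎))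
    where
    open ≡-Reasoning
    u = ups p + 0
    v = downs p + 0
    r₁ : ∀ a b → a + b + 0 ≡ b + (a + 0)
    r₁ = solve-∀
    u≡ : u ≡ k + l + g + v
    u≡ = trans (cong (_+ 0) height) (r₁ (downs p) (k + l + g))
    r₂ : ∀ k l g v → k + v + (l + g) ≡ k + l + g + v
    r₂ = solve-∀
    r₃ : ∀ k l g v → l + (k + v) + suc g ≡ suc (k + l + g + v)
    r₃ = solve-∀
    r₄ : ∀ k l g v → suc (k + l + g + v) ≡ suc g + (l + (k + v))
    r₄ = solve-∀
    r₅ : ∀ k l g a b → a + (k + l + g) + suc b ≡ a + (k + (l + (suc g + b)))
    r₅ = solve-∀

-- Descents of the swept word

desW-∷ʳ-descent : ∀ L {x y} → y < x → desW ((L ∷ʳ x) ∷ʳ y) ≡ suc (desW (L ∷ʳ x))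
desW-∷ʳ-descent []          y<x rewrite <⇒<ᵇ≡true y<x = refl
desW-∷ʳ-descent (z ∷ []) {x} y<x =
  trans (cong ((if x <ᵇ z then 1 else 0) +_) (desW-∷ʳ-descent [] y<x)) (+-suc (if x <ᵇ z then 1 else 0) 0)
desW-∷ʳ-descent (z ∷ z′ ∷ L) y<x =
  trans (cong (_ +_) (desW-∷ʳ-descent (z′ ∷ L) y<x)) (+-suc _ _)

desW-∷ʳ-≥ : ∀ L y → desW L ≤ desW (L ∷ʳ y)
desW-∷ʳ-≥ []           y = z≤n
desW-∷ʳ-≥ (z ∷ [])     y = z≤n
desW-∷ʳ-≥ (z ∷ z′ ∷ L) y = +-monoʳ-≤ _ (desW-∷ʳ-≥ (z′ ∷ L) y)

-- The cycle is strictly increasing on the letters that occur, so every descent persists.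
desW-map-cycle : ∀ {i j} → i < j → ∀ L → All (_≢ i) L → desW L ≤ desW (map (cycle i j) L)
desW-map-cycle i<j []       _        = z≤n
desW-map-cycle i<j (x ∷ []) _        = z≤n
desW-map-cycle {i} {j} i<j (x ∷ y ∷ L) (x≢i ∷ y≢i ∷ ≢i) = +-mono-≤ here (desW-map-cycle i<j (y ∷ L) (y≢i ∷ ≢i))
  where
  here : (if y <ᵇ x then 1 else 0) ≤ (if cycle i j y <ᵇ cycle i j x then 1 else 0)
  here with y <ᵇ x in eq
  ... | false = z≤n
  ... | true rewrite <⇒<ᵇ≡true (cycle-mono-< i<j y≢i x≢i (<ᵇ⇒< y x (≡true⇒T eq))) = ≤-refl

All-remove : ∀ {P : ℕ → Set} X {a Y} → All P (X ++ a ∷ Y) → All P (X ++ Y)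
All-remove X ps = All.++⁺ (All.++⁻ˡ X ps) (All.tail (All.++⁻ʳ X ps))

AllPairs-remove : ∀ {R : ℕ → ℕ → Set} X {a Y} → AllPairs R (X ++ a ∷ Y) → AllPairs R (X ++ Y)
AllPairs-remove []      (_ ∷ ps) = ps
AllPairs-remove (x ∷ X) (p ∷ ps) = All-remove X p ∷ AllPairs-remove X ps

AllPairs-++⁻ʳ : ∀ {R : ℕ → ℕ → Set} X {Y} → AllPairs R (X ++ Y) → AllPairs R Y
AllPairs-++⁻ʳ []      ps       = ps
AllPairs-++⁻ʳ (x ∷ X) (_ ∷ ps) = AllPairs-++⁻ʳ X ps

dec-prefix : ∀ X {a Y} → AllPairs _>_ (X ++ a ∷ Y) → All (a <_) X
dec-prefix []      _        = []
dec-prefix (x ∷ X) (p ∷ ps) = All.head (All.++⁻ʳ X p) ∷ dec-prefix X ps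

-- After a swap the moving label is `a` and the crossed one a - 1. As y ≤ a - 1, whatever lay below
-- `y` lies below both.
dec-raise : ∀ X {a y Y} → AllPairs _>_ (X ++ a ∷ y ∷ Y) → AllPairs _>_ (X ++ a ∷ pred a ∷ Y)
dec-raise [] {suc a} ((y<a ∷ ps) ∷ qs ∷ rs) =
  (≤-refl ∷ ps) ∷ All.map (λ z<y → <-≤-trans z<y (s≤s⁻¹ y<a)) qs ∷ rs
dec-raise (x ∷ X) {a} (ps ∷ rs) with All.++⁻ʳ X ps
... | a<x ∷ _ ∷ qs = All.++⁺ (All.++⁻ˡ X ps) (a<x ∷ ≤-<-trans pred[n]≤n a<x ∷ qs) ∷ dec-raise X rs

staircase : ℕ → List ℕ
staircase c = map suc (downFrom c)

staircase-≤ : ∀ c → All (_≤ c) (staircase c)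
staircase-≤ zero    = []
staircase-≤ (suc c) = ≤-refl ∷ All.map m≤n⇒m≤1+n (staircase-≤ c)

-- A and B hold the labels of the down-steps owed by the previous and the current bounce block, and the up-steps ahead
-- still carry c, c - 1, …, 1. L ends with the last label x of the swept word, which is prefixed by a sentinel N; k counts the
-- bounce peaks ahead, so count says that every swept step except those at a bounce peak creates a descent.
record Ready (n b : ℕ) (p : Path) (m g c k : ℕ) (σ : List ℕ) : Set where
  field
    done A B L  : List ℕ
    x N         : ℕ
    σ≡          : σ ≡ done ++ A ++ B ++ staircase c
    length-done : length done ≡ downs p
    length-A    : length A ≡ m
    length-B    : length B ≡ g
    perm        : IsPerm n σ
    word        : N ∷ canAux p σ σ ≡ L ∷ʳ x
    dec-BA      : AllPairs _>_ (B ++ A)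
    dec-xA      : AllPairs _>_ (x ∷ A)
    c<BA        : All (c <_) (B ++ A)
    c<Lx        : All (c <_) (L ∷ʳ x)
    count       : length p + k ≤ desW (L ∷ʳ x) + b

-- The next up-step, labelled y, has already crossed the down-steps labelled A₂ and has A₁ left to cross.
record Moving (n b : ℕ) (p : Path) (i j g c k : ℕ) (σ : List ℕ) : Set where
  field
    done A₁ A₂ B L : List ℕ
    x y N          : ℕ
    σ≡             : σ ≡ done ++ A₁ ++ A₂ ++ B ++ y ∷ staircase c
    length-done    : length done ≡ downs p
    length-A₁      : length A₁ ≡ i
    length-A₂      : length A₂ ≡ j
    length-B       : length B ≡ g
    perm           : IsPerm n σ
    word           : N ∷ canAux p σ σ ≡ L ∷ʳ x
    -- In these chains `y` stands where its up-step sits in the path, between `A₁` and `A₂`, and not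
    -- at its place in σ after `B`.
    dec-B          : AllPairs _>_ (B ++ A₁ ++ y ∷ A₂)
    dec-x          : AllPairs _>_ (x ∷ A₁ ++ y ∷ A₂)
    c<             : All (c <_) (B ++ A₁ ++ y ∷ A₂)
    Lx-ok          : All (λ z → c < z × z ≢ y) (L ∷ʳ x)
    count          : length p + k ≤ desW (L ∷ʳ x) + b

canAux-∷ʳ-D : ∀ p {us ds a ds′} → drop (downs p) ds ≡ a ∷ ds′ → canAux (p ∷ʳ D) us ds ≡ canAux p us ds ∷ʳ a
canAux-∷ʳ-D p {us} {ds} eq = trans (canAux-++ p (D ∷ []) us ds)
  (cong (λ z → canAux p us ds ++ canAux (D ∷ []) (drop (ups p) us) z) eq)

canAux-∷ʳ-U : ∀ p {us ds a us′} → drop (ups p) us ≡ a ∷ us′ → canAux (p ∷ʳ U) us ds ≡ canAux p us ds ∷ʳ a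
canAux-∷ʳ-U p {us} {ds} eq = trans (canAux-++ p (U ∷ []) us ds)
  (cong (λ z → canAux p us ds ++ canAux (U ∷ []) z (drop (downs p) ds)) eq)

drop-prefix : ∀ {A : Set} (xs : List A) {ys σ k} → σ ≡ xs ++ ys → length xs ≡ k → drop k σ ≡ ys
drop-prefix xs refl refl = drop-length-++ xs

extend-count : ∀ {b k} (p : Path) s L {x y} → y < x → length p + k ≤ desW (L ∷ʳ x) + b →
  length (p ∷ʳ s) + k ≤ desW ((L ∷ʳ x) ∷ʳ y) + b
extend-count p s L y<x h rewrite length-∷ʳ p s | desW-∷ʳ-descent L y<x = s≤s h

ready-down : ∀ {n b p m g c k σ} → Ready n b p (suc m) g c k σ → Ready n b (p ∷ʳ D) m g c k σ
ready-down {p = p} {k = k} record { done = done ; A = a ∷ A ; B = B ; L = L ; x = x ; N = N ; σ≡ = σ≡ ; length-done = ld ; length-A = lA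
                  ; length-B = lB ; perm = perm ; word = word ; dec-BA = decBA ; dec-xA = (a<x ∷ _) ∷ decA
                  ; c<BA = c<BA ; c<Lx = c<Lx ; count = count } = record
  { done = done ∷ʳ a ; A = A ; B = B ; L = L ∷ʳ x ; x = a ; N = N
  ; σ≡ = trans σ≡ (sym (∷ʳ-++ done a _))
  ; length-done = trans (length-∷ʳ done a) (trans (cong suc ld) (sym (downs-∷ʳ-D p)))
  ; length-A = suc-injective lA ; length-B = lB ; perm = perm
  ; word = trans (cong (N ∷_) (canAux-∷ʳ-D p (drop-prefix done σ≡ ld))) (cong (_∷ʳ a) word)
  ; dec-BA = AllPairs-remove B decBA ; dec-xA = decA
  ; c<BA = All-remove B c<BA ; c<Lx = All.∷ʳ⁺ c<Lx (All.head (All.++⁻ʳ B c<BA))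
  ; count = extend-count {k = k} p D L a<x count }

-- The step at a bounce peak need not create a descent: its unit of length is offset by the peak
-- leaving `k`. The labels `B` of the finished block become the owed ones.
ready-peak : ∀ {n b p g c k σ} → Ready n b p 0 (suc g) c (suc k) σ → Ready n b (p ∷ʳ D) g 0 c k σ
ready-peak {b = b} {p = p} {c = c} {k = k} record { done = done ; A = [] ; B = a ∷ B ; L = L ; x = x ; N = N ; σ≡ = σ≡ ; length-done = ld
                  ; length-B = lB ; perm = perm ; word = word ; dec-BA = decBA
                  ; c<BA = c<BA ; c<Lx = c<Lx ; count = count } = record
  { done = done ∷ʳ a ; A = B ; B = [] ; L = L ∷ʳ x ; x = a ; N = N
  ; σ≡ = trans σ≡ (sym (∷ʳ-++ done a _))
  ; length-done = trans (length-∷ʳ done a) (trans (cong suc ld) (sym (downs-∷ʳ-D p)))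
  ; length-A = suc-injective lB ; length-B = refl ; perm = perm
  ; word = trans (cong (N ∷_) (canAux-∷ʳ-D p (drop-prefix done σ≡ ld))) (cong (_∷ʳ a) word)
  ; dec-BA = AllPairs-++⁻ʳ (a ∷ []) dec ; dec-xA = dec
  ; c<BA = All.tail c<aB ; c<Lx = All.∷ʳ⁺ c<Lx (All.head c<aB)
  ; count = ≤-trans (≤-reflexive (trans (cong (_+ k) (length-∷ʳ p D)) (sym (+-suc (length p) k))))
      (≤-trans count (+-monoˡ-≤ b (desW-∷ʳ-≥ (L ∷ʳ x) a))) }
  where
  dec : AllPairs _>_ (a ∷ B)
  dec = subst (AllPairs _>_) (++-identityʳ (a ∷ B)) decBA
  c<aB : All (c <_) (a ∷ B)
  c<aB = subst (All (c <_)) (++-identityʳ (a ∷ B)) c<BA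

-- The next up-step carries `suc c`, the head of the staircase, which is below every label of the
-- chains and of the swept word; so it can close both chains.
moving-start : ∀ {n b p i g c k σ} → Ready n b p i g (suc c) k σ → Moving n b p i 0 g c k σ
moving-start {c = c} R = record
  { done = done ; A₁ = A ; A₂ = [] ; B = B ; L = L ; x = x ; y = suc c ; N = N
  ; σ≡ = σ≡ ; length-done = length-done ; length-A₁ = length-A ; length-A₂ = refl ; length-B = length-B
  ; perm = perm ; word = word
  ; dec-B = subst (AllPairs _>_) (++-assoc B A _) (AllPairs.++⁺ dec-BA ([] ∷ []) (All.map (_∷ []) c<BA))
  ; dec-x = AllPairs.++⁺ dec-xA ([] ∷ []) (All.map (_∷ []) (All.head (All.++⁻ʳ L c<Lx) ∷ All.++⁻ʳ B c<BA))
  ; c< = subst (All (c <_)) (++-assoc B A _) (All.∷ʳ⁺ (All.map <⇒≤ c<BA) ≤-refl)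
  ; Lx-ok = All.map (λ c<z → <⇒≤ c<z , ≢-sym (<⇒≢ c<z)) c<Lx
  ; count = count }
  where open Ready R

-- With nothing left to cross, `y` comes directly after `x` in the chain, so placing the up-step
-- creates a descent; `y` then joins `B` as its smallest label.
moving-end : ∀ {n b p i g c k σ} → ups p ≡ downs p + (i + g) → Moving n b p 0 i g c k σ → Ready n b (p ∷ʳ U) i (suc g) c k σ
moving-end {p = p} {c = c} {k = k} height record { done = done ; A₁ = [] ; A₂ = A ; B = B ; L = L ; x = x ; y = y ; N = N ; σ≡ = σ≡ ; length-done = ld
                         ; length-A₂ = lA ; length-B = lB ; perm = perm ; word = word ; dec-B = decB
                         ; dec-x = (y<x ∷ _) ∷ decA ; c< = c< ; Lx-ok = Lx-ok ; count = count } = record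
  { done = done ; A = A ; B = B ∷ʳ y ; L = L ∷ʳ x ; x = y ; N = N
  ; σ≡ = trans σ≡ (cong (λ z → done ++ A ++ z) (sym (∷ʳ-++ B y _)))
  ; length-done = trans ld (sym (downs-∷ʳ-U p))
  ; length-A = lA ; length-B = trans (length-∷ʳ B y) (cong suc lB) ; perm = perm
  ; word = trans (cong (N ∷_) (canAux-∷ʳ-U p (drop-prefix (done ++ A ++ B)
      (trans σ≡ (trans (cong (done ++_) (sym (++-assoc A B _))) (sym (++-assoc done (A ++ B) _)))) lens)))
      (cong (_∷ʳ y) word)
  ; dec-BA = subst (AllPairs _>_) (sym (∷ʳ-++ B y A)) decB ; dec-xA = decA
  ; c<BA = subst (All (c <_)) (sym (∷ʳ-++ B y A)) c<
  ; c<Lx = All.∷ʳ⁺ (All.map proj₁ Lx-ok) (All.head (All.++⁻ʳ B c<))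
  ; count = extend-count {k = k} p U L y<x count }
  where
  lens : length (done ++ A ++ B) ≡ ups p
  lens = trans (length-++ done) (trans (cong₂ _+_ ld (trans (length-++ A) (cong₂ _+_ lA lB))) (sym height))

record Swappable (n b : ℕ) (p : Path) (i j g c k : ℕ) (σ : List ℕ) : Set where
  field
    y a   : ℕ
    us ds : List ℕ
    us≡   : drop (ups p) σ ≡ y ∷ us
    ds≡   : drop (downs p + i) σ ≡ a ∷ ds
    y<a   : y < a
    moved : Moving n b p i (suc j) g c k (relabel y a σ)

-- If a is the last label of A₁, relabelling turns y into a and a into a - 1 and fixes the rest of A₁, A₂, B and the staircase.
moving-swappable : ∀ {n b p i j g c k σ} → ups p ≡ downs p + (suc i + j + g) → Moving n b p (suc i) j g c k σ → Swappable n b p i j g c k σ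
moving-swappable {n} {b} {p} {i} {j} {g} {c} {σ = σ} height record { A₁ = A } with initLast A
moving-swappable height record { length-A₁ = () } | []
moving-swappable {n} {b} {p} {i} {j} {g} {c} {σ = σ} height record { done = done ; A₂ = A₂ ; B = B ; L = L ; x = x ; y = y ; N = N ; σ≡ = σ≡ ; length-done = ld
                               ; length-A₁ = lA₁ ; length-A₂ = lA₂ ; length-B = lB ; perm = perm ; word = word ; dec-B = decB
                               ; dec-x = decx ; c< = c< ; Lx-ok = Lx-ok ; count = count } | A₁ ∷ʳ′ a = record
  { y = y ; a = a
  ; us≡ = drop-prefix (done ++ (A₁ ∷ʳ a) ++ A₂ ++ B) (trans σ≡ regroup) lens
  ; ds≡ = drop-prefix (done ++ A₁) σ≡′ (trans (length-++ done) (cong₂ _+_ ld lA₁′))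
  ; y<a = y<a
  ; moved = record
    -- The letter `x` exceeds `a` and is fixed. The sentinel passes through the cycle with the rest
    -- of the word, so the new `word` is the image of the old one.
    { done = map f done ; A₁ = A₁ ; A₂ = pred a ∷ A₂ ; B = B ; L = map f L ; x = x ; y = a ; N = f N
    ; σ≡ = trans (relabel≡map-cycle y a σ) (trans (cong (map f) (trans σ≡ (cong (done ++_) (∷ʳ-++ A₁ a _)))) image)
    ; length-done = trans (length-map f done) ld ; length-A₁ = lA₁′ ; length-A₂ = cong suc lA₂ ; length-B = lB
    ; perm = relabel-perm (≤-<-trans z≤n c<y) y<a a≤n perm
    ; word = trans (cong (f N ∷_) (trans (cong (λ z → canAux p z z) (relabel≡map-cycle y a σ))
               (map-canAux f (cycle-below (≤-<-trans z≤n c<y)) p σ σ))) (trans (cong (map f) word) map-Lx)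
    ; dec-B = subst (AllPairs _>_) (++-assoc B A₁ _) (dec-raise (B ++ A₁) decB′)
    ; dec-x = dec-raise (x ∷ A₁) decx′
    ; c< = subst (All (c <_)) (++-assoc B A₁ _)
        (All.++⁺ (All.++⁻ˡ (B ++ A₁) c<′) (<-trans c<y y<a ∷ <-≤-trans c<y (pred-mono-≤ y<a) ∷ All.tail (All.tail (All.++⁻ʳ (B ++ A₁) c<′))))
    ; Lx-ok = subst (All _) map-Lx
        (All.map⁺ (All.map (λ (c<z , z≢y) → cycle-> y<a z≢y c<y c<z , cycle-≢ y<a z≢y) Lx-ok))
    ; count = ≤-trans count (+-monoˡ-≤ b (subst (λ z → desW (L ∷ʳ x) ≤ desW z) map-Lx
        (desW-map-cycle y<a (L ∷ʳ x) (All.map proj₂ Lx-ok)))) } }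
  where
  f = cycle y a
  reassoc : B ++ (A₁ ∷ʳ a) ++ y ∷ A₂ ≡ (B ++ A₁) ++ a ∷ y ∷ A₂
  reassoc = trans (cong (B ++_) (∷ʳ-++ A₁ a _)) (sym (++-assoc B A₁ _))
  decB′ : AllPairs _>_ ((B ++ A₁) ++ a ∷ y ∷ A₂)
  decB′ = subst (AllPairs _>_) reassoc decB
  decx′ : AllPairs _>_ ((x ∷ A₁) ++ a ∷ y ∷ A₂)
  decx′ = subst (λ z → AllPairs _>_ (x ∷ z)) (∷ʳ-++ A₁ a _) decx
  c<′ : All (c <_) ((B ++ A₁) ++ a ∷ y ∷ A₂)
  c<′ = subst (All (c <_)) reassoc c<
  c<y : c < y
  c<y = All.head (All.tail (All.++⁻ʳ (B ++ A₁) c<′))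
  y<a : y < a
  y<a with AllPairs-++⁻ʳ (B ++ A₁) decB′
  ... | (y<a ∷ _) ∷ _ = y<a
  A₂<y : All (_< y) A₂
  A₂<y with AllPairs-++⁻ʳ (B ++ A₁) decB′
  ... | _ ∷ A₂<y ∷ _ = A₂<y
  lA₁′ : length A₁ ≡ i
  lA₁′ = suc-injective (trans (sym (length-∷ʳ A₁ a)) lA₁)
  σ≡′ : σ ≡ (done ++ A₁) ++ a ∷ A₂ ++ B ++ y ∷ staircase c
  σ≡′ = trans σ≡ (trans (cong (done ++_) (∷ʳ-++ A₁ a _)) (sym (++-assoc done A₁ _)))
  a≤n : a ≤ n
  a≤n = All.head (All.++⁻ʳ (done ++ A₁) (subst (All (_≤ n)) σ≡′ (IsPerm⇒All≤ perm)))
  regroup : done ++ (A₁ ∷ʳ a) ++ A₂ ++ B ++ y ∷ staircase c ≡ (done ++ (A₁ ∷ʳ a) ++ A₂ ++ B) ++ y ∷ staircase c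
  regroup = sym (trans (++-assoc done _ _) (cong (done ++_) (trans (++-assoc (A₁ ∷ʳ a) _ _) (cong ((A₁ ∷ʳ a) ++_) (++-assoc A₂ B _)))))
  lens : length (done ++ (A₁ ∷ʳ a) ++ A₂ ++ B) ≡ ups p
  lens = trans (length-++ done) (trans (cong₂ _+_ ld (trans (length-++ (A₁ ∷ʳ a))
    (trans (cong₂ _+_ lA₁ (trans (length-++ A₂) (cong₂ _+_ lA₂ lB))) (sym (+-assoc (suc i) j g))))) (sym height))
  fixes-above : ∀ {X} → All (a <_) X → map f X ≡ X
  fixes-above = map-id-local ∘ All.map (cycle-above y<a)
  fixes-below : ∀ {X} → All (_< y) X → map f X ≡ X
  fixes-below = map-id-local ∘ All.map cycle-below
  a<BA₁ : All (a <_) (B ++ A₁)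
  a<BA₁ = dec-prefix (B ++ A₁) decB′
  map-Lx : map f (L ∷ʳ x) ≡ map f L ∷ʳ x
  map-Lx = trans (map-++ f L _) (cong (map f L ∷ʳ_) (cycle-above y<a (All.head (dec-prefix (x ∷ A₁) decx′))))
  image : map f (done ++ A₁ ++ a ∷ A₂ ++ B ++ y ∷ staircase c)
        ≡ map f done ++ A₁ ++ pred a ∷ A₂ ++ B ++ a ∷ staircase c
  image = trans (map-++ f done _) (cong (map f done ++_)
    (trans (map-++ f A₁ _) (cong₂ _++_ (fixes-above (All.++⁻ʳ B a<BA₁))
    (cong₂ _∷_ (cycle-between y<a ≤-refl)
    (trans (map-++ f A₂ _) (cong₂ _++_ (fixes-below A₂<y)
    (trans (map-++ f B _) (cong₂ _++_ (fixes-above (All.++⁻ˡ B a<BA₁))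
    (cong₂ _∷_ (cycle-self y a) (fixes-below (All.map (λ z≤c → ≤-<-trans z≤c c<y) (staircase-≤ c))))))))))))

-- Running the procedure

-- The successor in the bound accounts for the descent from the sentinel to the first letter.
Outcome : ℕ → ℕ → Path → Path → List ℕ → Set
Outcome n b d e σ = ∃₂ λ τ fuel →
  run fuel d (e , σ) ≡ just (d , τ) × IsPerm n τ × length d ≤ suc (desW (can d τ)) + b

outcome-step : ∀ {n b d e σ e′ σ′} → pathEqᵇ e d ≡ false → step d (e , σ) ≡ just (e′ , σ′) →
  Outcome n b d e′ σ′ → Outcome n b d e σ
outcome-step {d = d} {e} {σ} {e′} {σ′} differ stp (τ , fuel , ran , rest) = τ , suc fuel , ran′ , rest
  where
  ran′ : run (suc fuel) d (e , σ) ≡ just (d , τ)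
  ran′ rewrite differ | stp = ran

replicate-D-∷ : ∀ k (e : Path) → replicate k D ++ D ∷ e ≡ D ∷ replicate k D ++ e
replicate-D-∷ zero    e = refl
replicate-D-∷ (suc k) e = cong (D ∷_) (replicate-D-∷ k e)

module _ {n b : ℕ} where

  -- The recursion is on the number `i` of down-steps left to cross; the continuation `finish`
  -- resumes the sweep once the up-step is in place.
  outcome-moving : ∀ i j {m g w e p σ} (S : Sweep m (suc g) w e) → m ≡ i + j →
    nonnegᵇ 0 0 p ≡ true → ups p ≡ downs p + (m + g) →
    (∀ {σ′} → Moving n b p 0 m g (ups w) (peaks S) σ′ → Outcome n b (p ++ U ∷ w) (p ++ U ∷ replicate m D ++ e) σ′) →
    Moving n b p i j g (ups w) (peaks S) σ →
    Outcome n b (p ++ U ∷ w) (p ++ replicate i D ++ U ∷ replicate j D ++ e) σ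
  outcome-moving zero    j S refl nn height finish M = finish M
  outcome-moving (suc i) j {m} {g} {w} {e} {p} {σ} S refl nn height finish M =
    -- After `p` the current path goes down where d goes up, so the loop has not stopped.
    outcome-step (pathEqᵇ-differ p (replicate i D ++ U ∷ replicate j D ++ e) w)
      (subst (λ z → step (p ++ U ∷ w) (p ++ z , σ) ≡ just (p ++ replicate i D ++ U ∷ D ∷ replicate j D ++ e , relabel y a σ))
        (replicate-D-∷ i (U ∷ replicate j D ++ e))
        (step-swap p w i (replicate j D ++ e) σ
          (intermediate-dyck {i} {suc j} S′ p nn (trans height (cong (λ z → downs p + (z + g)) m≡)))
          (intermediate-below {i} {suc j} S′ p) us≡ ds≡ y<a))
      (outcome-moving i (suc j) S m≡ nn height finish moved)
    where
    open Swappable (moving-swappable height M)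
    m≡ : suc i + j ≡ i + suc j
    m≡ = sym (+-suc i j)
    S′ : Sweep (i + suc j) (suc g) w e
    S′ = subst (λ z → Sweep z (suc g) w e) m≡ S

  outcome-done : ∀ {p σ} → Ready n b p 0 0 0 0 σ → Outcome n b p p σ
  outcome-done {p} {σ} R = σ , 0 , finished , perm , (begin
    length p                            ≡⟨ +-identityʳ (length p) ⟨
    length p + 0                        ≤⟨ count ⟩
    desW (L ∷ʳ x) + b                   ≡⟨ cong (λ z → desW z + b) word ⟨
    desW (N ∷ can p σ) + b              ≤⟨ +-monoˡ-≤ b (desW-∷-≤ N (can p σ)) ⟩
    suc (desW (can p σ)) + b            ∎)
    where
    open Ready R
    open ≤-Reasoning
    finished : run 0 p (p , σ) ≡ just (p , σ)
    finished rewrite pathEqᵇ-refl p = refl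

  -- Only `up` runs the procedure. In the cases `down` and `peak` the current path is unchanged and
  -- only the boundary of the prefix `p` advances.
  outcome-sweep : ∀ {m g w e d} p {σ} (S : Sweep m g w e) → d ≡ p ++ w → nonnegᵇ 0 0 d ≡ true →
    ups p ≡ downs p + (m + g) → Ready n b p m g (ups w) (peaks S) σ → Outcome n b d (p ++ replicate m D ++ e) σ
  outcome-sweep p {σ} end d≡ nn height R =
    subst (λ z → Outcome n b z (p ++ []) σ) (sym d≡) (subst (λ z → Outcome n b z z σ) (sym (++-identityʳ p)) (outcome-done R))
  outcome-sweep {d = d} p {σ} (down {m = m} {w = w} {e = e} S) d≡ nn height R =
    subst (λ z → Outcome n b d z σ) (∷ʳ-++ p D _)
      (outcome-sweep (p ∷ʳ D) S (trans d≡ (sym (∷ʳ-++ p D w))) nn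
        (trans (ups-∷ʳ-D p) (trans height (trans (+-suc (downs p) _) (cong (_+ _) (sym (downs-∷ʳ-D p)))))) (ready-down R))
  outcome-sweep {d = d} p {σ} (peak {g = g} {w = w} {e = e} S) d≡ nn height R =
    subst (λ z → Outcome n b d z σ) (∷ʳ-++ p D _)
      (outcome-sweep (p ∷ʳ D) S (trans d≡ (sym (∷ʳ-++ p D w))) nn
        (trans (ups-∷ʳ-D p) (trans height (trans (+-suc (downs p) g) (cong₂ _+_ (sym (downs-∷ʳ-D p)) (sym (+-identityʳ g)))))) (ready-peak R))
  outcome-sweep {m} {g} p {σ} (up {w = w} {e = e} S) refl nn height R =
    outcome-moving m 0 S (sym (+-identityʳ m)) (∧-trueˡ (trans (sym (nonnegᵇ-++ p (U ∷ w) 0 0)) nn)) height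
      (λ M → subst (λ z → Outcome n b (p ++ U ∷ w) z _) (∷ʳ-++ p U _)
        (outcome-sweep (p ∷ʳ U) S (sym (∷ʳ-++ p U w)) nn
          (trans (ups-∷ʳ-U p) (trans (cong suc height) (trans (sym (+-suc (downs p) (m + g)))
            (cong₂ _+_ (sym (downs-∷ʳ-U p)) (sym (+-suc m g)))))) (moving-end height M)))
      (moving-start R)

-- Comparing the two bounds.

All-canAux : ∀ {P : ℕ → Set} w → P 0 → ∀ {us ds} → All P us → All P ds → All P (canAux w us ds)
All-canAux []          p0 _        _        = []
All-canAux (true ∷ w)  p0 []       qs       = p0 ∷ All-canAux w p0 [] qs
All-canAux (true ∷ w)  p0 (p ∷ ps) qs       = p ∷ All-canAux w p0 ps qs
All-canAux (false ∷ w) p0 ps       []       = p0 ∷ All-canAux w p0 ps []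
All-canAux (false ∷ w) p0 ps       (q ∷ qs) = q ∷ All-canAux w p0 ps qs

-- On a nonempty word the sentinel always contributes exactly one descent, which cancels.
desW-sentinel : ∀ {n k} w → All (_≤ n) w → desW (suc n ∷ w) ≤ suc k → desW w ≤ k
desW-sentinel []      _         _ = z≤n
desW-sentinel (y ∷ w) (y≤n ∷ _) h rewrite <⇒<ᵇ≡true (s≤s y≤n) = s≤s⁻¹ h

theorem5p5 : (n : ℕ) (d : Path) → IsDyck n d →
    Σ (List ℕ) λ τ → Σ ℕ λ fuel →
    (run fuel d (initial n d) ≡ just (d , τ)) × InM n d τ
theorem5p5 n d dyck =
  let τ , fuel , ran , perm , bound = outcome-sweep [] S refl (nonneg⇒nonnegᵇ d (λ k → +-monoˡ-≤ 0 (nonneg k))) refl ready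
  in τ , fuel , subst (λ z → run fuel d (z , δ n) ≡ just (d , τ)) (sym (bounce-sweep S)) ran , perm , maximal τ bound
  where
  open IsDyck dyck
  S = proj₂ (dyck-sweep dyck)
  b = peaks S
  ready : Ready n b [] 0 0 (ups d) b (δ n)
  ready = record
    -- Initially the swept word is the sentinel alone, which exceeds every label.
    { done = [] ; A = [] ; B = [] ; L = [] ; x = suc n ; N = suc n
    ; σ≡ = trans (δ≡downFrom n) (cong staircase (sym ups-n))
    ; length-done = refl ; length-A = refl ; length-B = refl
    ; perm = ↭-reverse (oneToN n) ; word = refl
    ; dec-BA = [] ; dec-xA = [] ∷ [] ; c<BA = [] ; c<Lx = s≤s (≤-reflexive ups-n) ∷ [] ; count = ≤-refl }
  length-perm : ∀ {σ} → IsPerm n σ → length σ ≡ ups d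
  length-perm perm = trans (↭-length perm) (trans (length-map suc (upTo n)) (trans (length-upTo n) (sym ups-n)))
  upper : ∀ {σ} → IsPerm n σ → desW (suc n ∷ can d σ) + b ≤ length d
  upper {σ} perm = desW-sweep S (suc n) [] σ refl (length-perm perm)
  maximal : ∀ τ → length d ≤ suc (des d τ) + b → ∀ σ → IsPerm n σ → des d σ ≤ des d τ
  maximal τ bound σ perm = desW-sentinel (can d σ) (All-canAux d z≤n σ≤n σ≤n)
    -- Both bounds meet at `length d` with the same number `b` of bounce peaks.
    (+-cancelʳ-≤ b _ _ (≤-trans (upper perm) bound))
    where
    σ≤n = IsPerm⇒All≤ perm
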